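{- Let $T$ be a tree of order $n\ge 2$. Then $w(T) < \frac{3}{2}\pi(T)$.
   Context: For a tree $T$, between any two distinct vertices $x,y$ there is a unique path $P_{x,y}$. The all-to-all routing of $T$ is $R=\{P_{x,y} : \{x,y\}\subseteq V(T),\ x\ne y\}$ (one path per unordered pair of distinct vertices). A $k$-path-coloring $\phi: R\to\{1,\dots,k\}$ is proper if $\phi(P)\neq\phi(P')$ whenever the distinct paths $P,P'$ share at least one edge. The undirected optical index $w(T)$ is the minimum $k$ for which a proper $k$-path-coloring of $R$ exists. For an edge $e$, the edge-load $\ell_T(e)$ is the number of paths in $R$ containing $e$, and the edge-forwarding index is $\pi(T)=\max_{e\in E(T)}\ell_T(e)$. -}

module Defs where

open import Data.Nat using (ℕ; _≤_)
open import Data.Fin using (Fin) renaming (_<_ to _<ᶠ_)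
open import Data.List using (List; []; _∷_; length)
open import Data.List.Relation.Unary.Unique.Propositional using (Unique)
open import Data.List.Membership.Propositional using (_∈_)
open import Data.Product using (Σ; ∃; _×_; _,_; proj₁; proj₂)
open import Data.Sum using (_⊎_)
open import Relation.Nullary using (¬_)
open import Relation.Binary.PropositionalEquality using (_≡_; _≢_)
open import Function.Bundles using (_⇔_)

record SimpleGraph (n : ℕ) : Set₁ where
  field
    Adj       : Fin n → Fin n → Set
    symmetric : ∀ {x y} → Adj x y → Adj y x
    loopless  : ∀ {x} → ¬ Adj x x
open SimpleGraph public

module _ {n : ℕ} (G : SimpleGraph n) where

  data Walk : Fin n → Fin n → List (Fin n) → Set where
    here : ∀ {x} → Walk x x (x ∷ [])
    step : ∀ {x z y vs} → Adj G x z → Walk z y vs → Walk x y (x ∷ vs)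

  IsPath : Fin n → Fin n → List (Fin n) → Set
  IsPath x y vs = Walk x y vs × Unique vs

  Connected : Set
  Connected = ∀ x y → ∃ λ vs → Walk x y vs

  IsCycle : List (Fin n) → Set
  IsCycle vs = Σ (Fin n) λ x → Σ (Fin n) λ y →
    IsPath x y vs × Adj G y x × 3 ≤ length vs

  Acyclic : Set
  Acyclic = ∀ vs → ¬ IsCycle vs

  IsTree : Set
  IsTree = Connected × Acyclic

data Consec {n : ℕ} (u v : Fin n) : List (Fin n) → Set where
  here  : ∀ {vs} → Consec u v (u ∷ v ∷ vs)
  there : ∀ {w vs} → Consec u v vs → Consec u v (w ∷ vs)

module _ {n : ℕ} (G : SimpleGraph n) where

  -- The edge {u,v} lies on the path P_{x,y} (which is unique in a tree).
  OnPath : Fin n → Fin n → Fin n → Fin n → Set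
  OnPath u v x y = Σ (List (Fin n)) λ vs →
    IsPath G x y vs × (Consec u v vs ⊎ Consec v u vs)

  -- Unordered pairs {x,y}, x ≠ y, are represented as (x , y) with x < y.
  -- Load u v m : the edge {u,v} lies on exactly m paths of the all-to-all routing.
  Load : Fin n → Fin n → ℕ → Set
  Load u v m = Σ (List (Fin n × Fin n)) λ l →
    Unique l ×
    (∀ p → (p ∈ l) ⇔ (proj₁ p <ᶠ proj₂ p × OnPath u v (proj₁ p) (proj₂ p))) ×
    length l ≡ m

  IsForwardingIndex : ℕ → Set
  IsForwardingIndex π =
    (Σ (Fin n) λ u → Σ (Fin n) λ v → Adj G u v × Load u v π) ×
    (∀ u v m → Adj G u v → Load u v m → m ≤ π)

  ShareEdge : Fin n → Fin n → Fin n → Fin n → Set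
  ShareEdge x y x' y' = Σ (Fin n) λ u → Σ (Fin n) λ v →
    Adj G u v × OnPath u v x y × OnPath u v x' y'

  -- φ x y is the colour of P_{x,y} (only values with x < y are relevant).
  ProperColoring : (k : ℕ) → (Fin n → Fin n → Fin k) → Set
  ProperColoring k φ = ∀ x y x' y' → x <ᶠ y → x' <ᶠ y' →
    ¬ ((x ≡ x') × (y ≡ y')) → ShareEdge x y x' y' → φ x y ≢ φ x' y'

  HasProperColoring : ℕ → Set
  HasProperColoring k = Σ (Fin n → Fin n → Fin k) (ProperColoring k)

  IsOpticalIndex : ℕ → Set
  IsOpticalIndex w = HasProperColoring w × (∀ k → HasProperColoring k → w ≤ k)

{-# OPTIONS --safe #-}

-- Let uv be an edge of maximum load and root T at the endpoint c on its larger
-- side. If a is the number of vertices on the smaller side then 2a ≤ n,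
-- π = a(n - a), and by maximality every branch at c has at most a vertices.
-- Colour the paths greedily in order of increasing depth of the lowest common
-- ancestor of their ends. If a path descends from its topmost vertex into child
-- subtrees of sizes X and Y, and r = n - X - Y, then it and the conflicting
-- paths coloured before it number at most XY + Xr + Yr, since each of these
-- separates one of the two subtrees from the rest. This is < 3π/2 when the
-- topmost vertex is not c, because then X + Y < a, and also when 3a > n, because
-- it is at most n²/3. When 3a ≤ n, the paths having c as an inner vertex are
-- coloured beforehand: number the vertices other than c so that branches are
-- intervals, and give the pair {i,j} the colour consisting of i + j mod (n - 1)
-- and its place modulo a among the pairs with that sum. This takes
-- (n - 1)a < 3π/2 colours.

module Submission where

open import Defs
open import Level using (0ℓ)
open import Data.Nat
open import Data.Nat.Properties
open import Data.Nat.DivMod using (m≡m%n+[m/n]*n; m%n<n)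
open import Data.Nat.Tactic.RingSolver using (solve-∀)
open import Data.Fin using (Fin; toℕ; fromℕ<; combine)
import Data.Fin as F
import Data.Fin.Properties as F
open import Data.Sum using (_⊎_; inj₁; inj₂; [_,_]′; swap)
open import Data.Product using (_×_; _,_; ∃; ∃₂; Σ; proj₁; proj₂; uncurry)
open import Data.Product.Properties using (≡-dec)
open import Data.List using (List; []; _∷_; _++_; length; map; filter; allFin; cartesianProduct; lookup)
open import Data.List.Properties using (length-++; length-map; filter-all; length-tabulate)
open import Data.List.Extrema.Nat using (max; xs≤max)
open import Data.List.Membership.Propositional using (_∈_; _∉_)
open import Data.List.Membership.Propositional.Properties
open import Data.List.Membership.Propositional.Properties.WithK using (unique∧set⇒bag)
import Data.List.Membership.DecPropositional as DecMembership
open import Data.List.Relation.Unary.Any using (here; there; index)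
open import Data.List.Relation.Unary.Any.Properties using (lookup-index)
import Data.List.Relation.Unary.All as All
open import Data.List.Relation.Unary.All.Properties using (¬Any⇒All¬; All¬⇒¬Any)
open import Data.List.Relation.Unary.AllPairs using ([]; _∷_)
open import Data.List.Relation.Unary.Unique.Propositional using (Unique)
open import Data.List.Relation.Unary.Unique.Propositional.Properties using (cartesianProduct⁺; filter⁺; allFin⁺)
open import Data.List.Relation.Binary.BagAndSetEquality using (∼bag⇒↭)
open import Data.List.Relation.Binary.Permutation.Propositional.Properties using (↭-length)
open import Data.Empty using (⊥)
open import Function using (_∘_)
open import Function.Bundles using (mk⇔; Equivalence)
open import Relation.Nullary using (¬_; Dec; yes; no; contradiction; ¬?)
open import Relation.Nullary.Decidable using (_×-dec_; _⊎-dec_)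
open import Relation.Unary using (Pred; Decidable)
open import Relation.Binary.Definitions using (DecidableEquality; tri<; tri≈; tri>)
open import Relation.Binary.PropositionalEquality

-- Arithmetic bounds

-- Fixes the palette size. With `A` equal to 3ab, every conflict count below half of `A` fits into
-- `K`, while `K` itself stays below that half, as the theorem demands.
half : ∀ A → 1 ≤ A → ∃ λ K → 2 * K < A × (∀ f → 2 * f < A → f ≤ K)
half (suc zero) _ = 0 , s≤s z≤n , λ { zero _ → z≤n ; (suc f) (s≤s ()) }
half (suc (suc zero)) _ = 0 , s≤s z≤n , λ { zero _ → z≤n
  ; (suc f) (s≤s (s≤s h)) → contradiction (subst (_≤ 0) (+-suc f (f + 0)) h) λ () }
half (suc (suc (suc A))) _ with half (suc A) (s≤s z≤n)
... | K , lt , max = suc K , subst (_< 3 + A) (sym (*-suc 2 K)) (s≤s (s≤s lt)) , max′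
  where
  max′ : ∀ f → 2 * f < 3 + A → f ≤ suc K
  max′ zero    _ = z≤n
  max′ (suc f) h = s≤s (max f (s≤s⁻¹ (s≤s⁻¹ (subst (_< 3 + A) (*-suc 2 f) h))))

2xy≤x²+y² : ∀ x y → 2 * (x * y) ≤ x * x + y * y
2xy≤x²+y² x y with ≤-total x y
... | inj₁ h with k , refl ← m≤n⇒∃[o]m+o≡n h = subst (2 * (x * (x + k)) ≤_) (eq x k) (m≤m+n _ (k * k))
  where
  eq : ∀ x k → 2 * (x * (x + k)) + k * k ≡ x * x + (x + k) * (x + k)
  eq = solve-∀
... | inj₂ h with k , refl ← m≤n⇒∃[o]m+o≡n h = subst (2 * ((y + k) * y) ≤_) (eq y k) (m≤m+n _ (k * k))
  where
  eq : ∀ y k → 2 * ((y + k) * y) + k * k ≡ (y + k) * (y + k) + y * y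
  eq = solve-∀

-- The difference of the two sides is half the sum of the squared pairwise differences; hence the
-- doubling, after which each product is compared with two squares.
3pairs≤square : ∀ x y r → 3 * (x * y + x * r + y * r) ≤ (x + y + r) * (x + y + r)
3pairs≤square x y r = *-cancelˡ-≤ 2 (begin
  2 * (3 * (x * y + x * r + y * r))
    ≡⟨ e₁ x y r ⟩
  2 * (x * y) + 2 * (x * r) + 2 * (y * r) + 4 * (x * y + x * r + y * r)
    ≤⟨ +-monoˡ-≤ _ (+-mono-≤ (+-mono-≤ (2xy≤x²+y² x y) (2xy≤x²+y² x r)) (2xy≤x²+y² y r)) ⟩
  x * x + y * y + (x * x + r * r) + (y * y + r * r) + 4 * (x * y + x * r + y * r)
    ≡⟨ e₂ x y r ⟩
  2 * ((x + y + r) * (x + y + r)) ∎)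
  where
  open ≤-Reasoning
  e₁ : ∀ x y r → 2 * (3 * (x * y + x * r + y * r)) ≡ 2 * (x * y) + 2 * (x * r) + 2 * (y * r) + 4 * (x * y + x * r + y * r)
  e₁ = solve-∀
  e₂ : ∀ x y r → x * x + y * y + (x * x + r * r) + (y * y + r * r) + 4 * (x * y + x * r + y * r) ≡ 2 * ((x + y + r) * (x + y + r))
  e₂ = solve-∀

-- With m = 2n - 3a and k = 3a - n the gap 9a(n - a) - 2n² equals mk, where n = a + b.
central-bound : ∀ a b x y r → x + y + r ≡ a + b → a ≤ b → a + b < 3 * a →
  2 * (x * y + x * r + y * r) < 3 * (a * b)
central-bound a b x y r e a≤b h = *-cancelˡ-< 3 _ _ (begin-strict
  3 * (2 * f) ≡⟨ e₁ f ⟩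
  2 * (3 * f) ≤⟨ *-monoʳ-≤ 2 (3pairs≤square x y r) ⟩
  2 * ((x + y + r) * (x + y + r)) ≡⟨ cong (λ t → 2 * (t * t)) e ⟩
  2 * ((a + b) * (a + b)) <⟨ main ⟩
  3 * (3 * (a * b)) ∎)
  where
  open ≤-Reasoning
  f = x * y + x * r + y * r
  e₁ : ∀ f → 3 * (2 * f) ≡ 2 * (3 * f)
  e₁ = solve-∀
  b<2a : b < a + a
  b<2a = +-cancelˡ-< a _ _ (subst (a + b <_) (e₂ a) h)
    where
    e₂ : ∀ a → 3 * a ≡ a + (a + a)
    e₂ = solve-∀
  main : 2 * ((a + b) * (a + b)) < 3 * (3 * (a * b))
  -- Here `j` is b - a, and `k` is one less than 3a - n, which is positive by `b<2a`. The gap is the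
  -- product of 1 + k and 1 + k + 3j, written as a successor to show strictness.
  main with j , refl ← m≤n⇒∃[o]m+o≡n a≤b
       with k , refl ← m≤n⇒∃[o]m+o≡n (+-cancelˡ-< a _ _ b<2a) =
    subst (2 * ((a + (a + j)) * (a + (a + j))) <_) (e₃ j k) (m<m+n _ (s≤s z≤n))
    where
    e₃ : ∀ j k → 2 * ((suc j + k + (suc j + k + j)) * (suc j + k + (suc j + k + j)))
       + suc (k * (1 + k + 3 * j) + k + 3 * j) ≡ 3 * (3 * ((suc j + k) * (suc j + k + j)))
    e₃ = solve-∀

-- At a fixed sum, moving the smaller factor up towards half the sum increases the product; `d` is
-- the amount moved.
product-mono : ∀ {a b t r} → t + r ≡ a + b → t ≤ a → a ≤ b → t * r ≤ a * b
product-mono {a} {b} {t} {r} e t≤a a≤b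
  with d , refl ← m≤n⇒∃[o]m+o≡n t≤a
  with refl ← +-cancelˡ-≡ t r (d + b) (trans e (+-assoc t d b)) = begin
    t * (d + b) ≡⟨ e₃ t d b ⟩
    t * b + d * t ≤⟨ +-monoʳ-≤ (t * b) (*-monoʳ-≤ d (≤-trans t≤a a≤b)) ⟩
    t * b + d * b ≡⟨ *-distribʳ-+ b t d ⟨
    (t + d) * b ∎
  where
  open ≤-Reasoning
  e₃ : ∀ t d b → t * (d + b) ≡ t * b + d * t
  e₃ = solve-∀

-- Twice xy is at most the square of x + y, hence less than ab. The other two terms form (x + y)r,
-- which is at most ab by `product-mono`.
low-bound : ∀ a b x y r → x + y + r ≡ a + b → a ≤ b → x + y < a →
  2 * (x * y + x * r + y * r) < 3 * (a * b)
low-bound a b x y r e a≤b h = begin-strict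
  2 * (x * y + x * r + y * r) ≡⟨ e₁ x y r ⟩
  2 * (x * y) + 2 * ((x + y) * r) <⟨ +-mono-<-≤ p (*-monoʳ-≤ 2 q) ⟩
  a * b + 2 * (a * b) ≡⟨ refl ⟩
  3 * (a * b) ∎
  where
  open ≤-Reasoning
  e₁ : ∀ x y r → 2 * (x * y + x * r + y * r) ≡ 2 * (x * y) + 2 * ((x + y) * r)
  e₁ = solve-∀
  e₂ : ∀ x y → 2 * (x * y) + (x * x + y * y) ≡ (x + y) * (x + y)
  e₂ = solve-∀
  p : 2 * (x * y) < a * b
  p = begin-strict
    2 * (x * y) ≤⟨ m≤m+n _ _ ⟩
    2 * (x * y) + (x * x + y * y) ≡⟨ e₂ x y ⟩
    (x + y) * (x + y) <⟨ *-mono-< h h ⟩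
    a * a ≤⟨ *-monoʳ-≤ a a≤b ⟩
    a * b ∎
  q : (x + y) * r ≤ a * b
  q = product-mono e (<⇒≤ h) a≤b

-- Read `a` and `b` as the sizes of two disjoint branches and `r` as the number of remaining
-- vertices: the hypothesis compares two edge loads, and their common term ab cancels.
cross-cancel : ∀ a b r → 1 ≤ r → b * (a + r) ≤ a * (b + r) → b ≤ a
cross-cancel a b (suc r) _ h = *-cancelʳ-≤ b a (suc r) (+-cancelˡ-≤ (a * b) _ _ (begin
  a * b + b * suc r ≡⟨ e b a (suc r) ⟩
  b * (a + suc r)   ≤⟨ h ⟩
  a * (b + suc r)   ≡⟨ *-distribˡ-+ a b (suc r) ⟩
  a * b + a * suc r ∎))
  where
  open ≤-Reasoning
  e : ∀ b a r → a * b + b * r ≡ b * (a + r)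
  e = solve-∀

-- The last hypothesis amounts to 2a ≤ b; strictness comes from replacing `N` by a + b.
explicit-bound : ∀ a b N → 1 ≤ a → N < a + b → 3 * a ≤ a + b → 2 * (N * a) < 3 * (a * b)
explicit-bound a@(suc _) b N _ N<n h = begin-strict
  2 * (N * a) <⟨ *-monoʳ-< 2 (*-monoˡ-< a N<n) ⟩
  2 * ((a + b) * a) ≡⟨ e₁ a b ⟩
  a * (2 * a) + 2 * (a * b) ≤⟨ +-monoˡ-≤ _ (*-monoʳ-≤ a (+-cancelˡ-≤ a _ _ h)) ⟩
  a * b + 2 * (a * b) ≡⟨ refl ⟩
  3 * (a * b) ∎
  where
  open ≤-Reasoning
  e₁ : ∀ a b → 2 * ((a + b) * a) ≡ a * (2 * a) + 2 * (a * b)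
  e₁ = solve-∀

-- Residues and positions on a circle

%-gap : ∀ {a} .{{_ : NonZero a}} {u v} → u % a ≡ v % a → u < v → u + a ≤ v
%-gap {a} {u} {v} e u<v = begin
  u + a ≡⟨ cong (_+ a) (m≡m%n+[m/n]*n u a) ⟩
  u % a + (u / a) * a + a ≡⟨ trans (+-assoc (u % a) _ a) (cong₂ _+_ e (+-comm _ a)) ⟩
  v % a + suc (u / a) * a ≤⟨ +-monoʳ-≤ (v % a) (*-monoˡ-≤ a q) ⟩
  v % a + (v / a) * a ≡⟨ m≡m%n+[m/n]*n v a ⟨
  v ∎
  where
  open ≤-Reasoning
  q : u / a < v / a
  q with u / a <? v / a
  ... | yes h = h
  ... | no h = contradiction u<v (≤⇒≯ (subst₂ _≤_ (sym (m≡m%n+[m/n]*n v a)) (sym (m≡m%n+[m/n]*n u a))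
                 (+-mono-≤ (≤-reflexive (sym e)) (*-monoˡ-≤ a (≮⇒≥ h)))))

-- Serves to read off the class and the residue of the phase from a `colour`.
quot-rem-unique : ∀ a {q q′ r r′} → r < a → r′ < a → q * a + r ≡ q′ * a + r′ → q ≡ q′ × r ≡ r′
quot-rem-unique a {q} {q′} {r} {r′} r<a r′<a e with <-cmp q q′
... | tri≈ _ refl _ = refl , +-cancelˡ-≡ (q * a) r r′ e
... | tri< h _ _ = contradiction e (<⇒≢ (<-≤-trans (+-monoʳ-< (q * a) r<a)
        (≤-trans (≤-reflexive (+-comm (q * a) a)) (≤-trans (*-monoˡ-≤ a h) (m≤m+n _ r′)))))
... | tri> _ _ h = contradiction (sym e) (<⇒≢ (<-≤-trans (+-monoʳ-< (q′ * a) r′<a)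
        (≤-trans (≤-reflexive (+-comm (q′ * a) a)) (≤-trans (*-monoˡ-≤ a h) (m≤m+n _ r)))))

Far : ℕ → ℕ → ℕ → Set
Far a u v = u + a ≤ v ⊎ v + a ≤ u

-- Two conflicting paths through the root have ends in a common branch, and a branch will span fewer
-- than `a` steps of position. So pairs in this relation may share a colour.
AllFar : (a i j i′ j′ : ℕ) → Set
AllFar a i j i′ j′ = (Far a i i′ × Far a i j′) × (Far a j i′ × Far a j j′)

-- Think of the N positions as points on a circle. The class of a pair {i,j} is
-- the axis i + j mod N of the reflection exchanging i and j, and the phase
-- (i or j - N, shifted by N to stay in ℕ) numbers the pairs with this axis
-- consecutively, so pairs of one class with congruent phases are a apart.
module CyclicColour (a N : ℕ) .{{_ : NonZero a}} where

  class : ℕ → ℕ → ℕ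
  class i j with i + j <? N
  ... | yes _ = i + j
  ... | no  _ = i + j ∸ N

  phase : ℕ → ℕ → ℕ
  phase i j with i + j <? N
  ... | yes _ = i + N
  ... | no  _ = j

  colour : ℕ → ℕ → ℕ
  colour i j = class i j * a + phase i j % a

  class<N : ∀ {i j} → i < j → j < N → class i j < N
  class<N {i} {j} i<j j<N with i + j <? N
  ... | yes h = h
  ... | no  h = +-cancelʳ-< N (i + j ∸ N) N (subst (_< N + N) (sym (m∸n+n≡m (≮⇒≥ h))) (+-mono-< (<-trans i<j j<N) j<N))

  colour<N*a : ∀ {i j} → i < j → j < N → colour i j < N * a
  colour<N*a {i} {j} i<j j<N = <-≤-trans (+-monoʳ-< _ (m%n<n (phase i j) a))
    (≤-trans (≤-reflexive (+-comm (class i j * a) a)) (*-monoˡ-≤ a (class<N i<j j<N)))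

  -- Equal sums make the pairs concentric intervals, so the right end moves inwards exactly as far
  -- as the left end.
  nested : ∀ {i j i′ j′} → i + a ≤ i′ → i′ < j′ → i + j ≡ i′ + j′ → AllFar a i j i′ j′
  nested {i} {j} {i′} {j′} h i′<j′ e = (inj₁ h , inj₁ (≤-trans h (<⇒≤ i′<j′))) , (inj₂ (≤-trans (+-monoˡ-≤ a (<⇒≤ i′<j′)) k) , inj₂ k)
    where
    k : j′ + a ≤ j
    k = +-cancelˡ-≤ i (j′ + a) j (begin
      i + (j′ + a) ≡⟨ trans (cong (i +_) (+-comm j′ a)) (sym (+-assoc i a j′)) ⟩
      i + a + j′ ≤⟨ +-monoˡ-≤ j′ h ⟩
      i′ + j′ ≡⟨ e ⟨
      i + j ∎)
      where open ≤-Reasoning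

  -- On the circle the two pairs have the same axis. The reflection in it carries the arc from `j′`
  -- to `i + N` onto the arc between `j` and `i′`, so both arcs have length at least `a`.
  separated : ∀ {i j i′ j′} → i < j → i′ < j′ → i + j + N ≡ i′ + j′ → j′ + a ≤ i + N → AllFar a i j i′ j′
  separated {i} {j} {i′} {j′} i<j i′<j′ e h = (inj₁ (≤-trans l k) , inj₁ (≤-trans l k′)) , (inj₁ k , inj₁ k′)
    where
    l : i + a ≤ j + a
    l = +-monoˡ-≤ a (<⇒≤ i<j)
    k : j + a ≤ i′
    k = +-cancelʳ-≤ j′ (j + a) i′ (begin
      j + a + j′ ≡⟨ trans (+-assoc j a j′) (cong (j +_) (+-comm a j′)) ⟩
      j + (j′ + a) ≤⟨ +-monoʳ-≤ j h ⟩
      j + (i + N) ≡⟨ trans (sym (+-assoc j i N)) (cong (_+ N) (+-comm j i)) ⟩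
      i + j + N ≡⟨ e ⟩
      i′ + j′ ∎)
      where open ≤-Reasoning
    k′ : j + a ≤ j′
    k′ = ≤-trans k (<⇒≤ i′<j′)

  allFar-sym : ∀ {i j i′ j′} → AllFar a i j i′ j′ → AllFar a i′ j′ i j
  allFar-sym ((p , q) , (r , s)) = (swap p , swap r) , (swap q , swap s)

  same-sum : ∀ {i j i′ j′} → i < j → i′ < j′ → i + j ≡ i′ + j′ → ¬ (i ≡ i′ × j ≡ j′) →
    (i < i′ → i + a ≤ i′) → (i′ < i → i′ + a ≤ i) → AllFar a i j i′ j′
  same-sum {i} {j} {i′} {j′} i<j i′<j′ e ne f g with <-cmp i i′
  ... | tri< h _ _ = nested (f h) i′<j′ e
  ... | tri≈ _ refl _ = contradiction (refl , +-cancelˡ-≡ i j j′ e) ne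
  ... | tri> _ _ h = allFar-sym (nested (g h) i<j (sym e))

  -- When the sum wraps around, the phase is the larger end. Congruence then separates the right
  -- ends, and equal sums pass the gap on to the left ends.
  gap-transfer : ∀ {i j i′ j′} → i + j ≡ i′ + j′ → j′ % a ≡ j % a → i < i′ → i + a ≤ i′
  gap-transfer {i} {j} {i′} {j′} e m h = +-cancelʳ-≤ j′ (i + a) i′ (begin
      i + a + j′ ≡⟨ trans (+-assoc i a j′) (cong (i +_) (+-comm a j′)) ⟩
      i + (j′ + a) ≤⟨ +-monoʳ-≤ i (%-gap m (+-cancelˡ-< i j′ j (<-≤-trans (+-monoˡ-< j′ h) (≤-reflexive (sym e))))) ⟩
      i + j ≡⟨ e ⟩
      i′ + j′ ∎)
      where open ≤-Reasoning

  colour-far : ∀ {i j i′ j′} → i < j → j < N → i′ < j′ → j′ < N → ¬ (i ≡ i′ × j ≡ j′) →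
    colour i j ≡ colour i′ j′ → AllFar a i j i′ j′
  colour-far {i} {j} {i′} {j′} i<j j<N i′<j′ j′<N ne eq
    with quot-rem-unique a {class i j} {class i′ j′} (m%n<n (phase i j) a) (m%n<n (phase i′ j′) a) eq
  ... | q , r with i + j <? N | i′ + j′ <? N
  ... | yes h | yes h′ = same-sum i<j i′<j′ q ne
          (λ l → +N-cancel (%-gap r (+-monoˡ-< N l)))
          (λ l → +N-cancel (%-gap (sym r) (+-monoˡ-< N l)))
    where
    +N-cancel : ∀ {u v} → u + N + a ≤ v + N → u + a ≤ v
    +N-cancel {u} {v} h = +-cancelʳ-≤ N (u + a) v (subst (_≤ v + N)
      (trans (+-assoc u N a) (trans (cong (u +_) (+-comm N a)) (sym (+-assoc u a N)))) h)
  ... | no h  | no h′  = same-sum i<j i′<j′ e ne (gap-transfer e (sym r)) (gap-transfer (sym e) r)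
    where
    e : i + j ≡ i′ + j′
    e = ∸-cancelʳ-≡ (≮⇒≥ h) (≮⇒≥ h′) q
  -- Only the second pair wraps around: the phases are `i + N` and `j′`, and `j′ < N` makes the
  -- latter the smaller one.
  ... | yes h | no h′  = separated i<j i′<j′ (trans (cong (_+ N) q) (m∸n+n≡m (≮⇒≥ h′)))
          (%-gap (sym r) (<-≤-trans j′<N (m≤n+m N i)))
  ... | no h  | yes h′ = allFar-sym (separated i′<j′ i<j (trans (cong (_+ N) (sym q)) (m∸n+n≡m (≮⇒≥ h)))
          (%-gap r (<-≤-trans j<N (m≤n+m N i′))))

  -- The ends of a path are ordered as vertices and not by position, so a version for unordered
  -- pairs of positions is required.
  colourₛ : ℕ → ℕ → ℕ
  colourₛ i j = colour (i ⊓ j) (i ⊔ j)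

  sorted : ∀ {i j} → i ≢ j → (i < j × i ⊓ j ≡ i × i ⊔ j ≡ j) ⊎ (j < i × i ⊓ j ≡ j × i ⊔ j ≡ i)
  sorted {i} {j} ne with <-cmp i j
  ... | tri< h _ _ = inj₁ (h , m≤n⇒m⊓n≡m (<⇒≤ h) , m≤n⇒m⊔n≡n (<⇒≤ h))
  ... | tri≈ _ e _ = contradiction e ne
  ... | tri> _ _ h = inj₂ (h , m≥n⇒m⊓n≡n (<⇒≤ h) , m≥n⇒m⊔n≡m (<⇒≤ h))

  colourₛ<N*a : ∀ {i j} → i ≢ j → i < N → j < N → colourₛ i j < N * a
  colourₛ<N*a ne i<N j<N with sorted ne
  ... | inj₁ (h , e , f) rewrite e | f = colour<N*a h j<N
  ... | inj₂ (h , e , f) rewrite e | f = colour<N*a h i<N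

  colourₛ-far : ∀ {i j i′ j′} → i ≢ j → i < N → j < N → i′ ≢ j′ → i′ < N → j′ < N →
    ¬ ((i ≡ i′ × j ≡ j′) ⊎ (i ≡ j′ × j ≡ i′)) → colourₛ i j ≡ colourₛ i′ j′ → AllFar a i j i′ j′
  colourₛ-far ne i<N j<N ne′ i′<N j′<N d eq with sorted ne | sorted ne′
  ... | inj₁ (h , e , f) | inj₁ (h′ , e′ , f′) rewrite e | f | e′ | f′ =
        colour-far h j<N h′ j′<N (d ∘ inj₁) eq
  ... | inj₁ (h , e , f) | inj₂ (h′ , e′ , f′) rewrite e | f | e′ | f′ =
        let (p , q) , (r , s) = colour-far h j<N h′ i′<N (d ∘ inj₂) eq in (q , p) , (s , r)
  ... | inj₂ (h , e , f) | inj₁ (h′ , e′ , f′) rewrite e | f | e′ | f′ =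
        let (p , q) , (r , s) = colour-far h i<N h′ j′<N (λ { (k , l) → d (inj₂ (l , k)) }) eq in (r , s) , (p , q)
  ... | inj₂ (h , e , f) | inj₂ (h′ , e′ , f′) rewrite e | f | e′ | f′ =
        let (p , q) , (r , s) = colour-far h i<N h′ i′<N (λ { (k , l) → d (inj₁ (l , k)) }) eq in (s , r) , (q , p)

-- Counting

length-cartesianProduct : ∀ {A B : Set} (xs : List A) (ys : List B) →
  length (cartesianProduct xs ys) ≡ length xs * length ys
length-cartesianProduct []       ys = refl
length-cartesianProduct (x ∷ xs) ys = trans (length-++ (map (x ,_) ys))
  (cong₂ _+_ (length-map (x ,_) ys) (length-cartesianProduct xs ys))

unique-map : ∀ {A B : Set} (f : A → B) {xs} → Unique xs →
  (∀ {x y} → x ∈ xs → y ∈ xs → f x ≡ f y → x ≡ y) → Unique (map f xs)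
unique-map f []        inj = []
unique-map f {x ∷ xs} (x∉ ∷ u) inj =
  All.tabulate (λ v∈ e → let y , y∈ , e′ = ∈-map⁻ f v∈ in
    All.lookup x∉ y∈ (inj (here refl) (there y∈) (trans e e′)))
  ∷ unique-map f u (λ p q → inj (there p) (there q))

-- If all `K + 1` candidates occurred, two of them would be found at the same index by the
-- pigeonhole principle.
fresh : ∀ K (xs : List ℕ) → length xs ≤ K → ∃ λ k → k ≤ K × k ∉ xs
fresh K xs h with F.¬∀⟶∃¬ (suc K) (λ i → toℕ i ∈ xs) (λ i → DecMembership._∈?_ _≟_ (toℕ i) xs) ¬all
  where
  ¬all : ¬ (∀ i → toℕ i ∈ xs)
  ¬all all with i , j , i<j , e ← F.pigeonhole (s≤s h) (λ i → index (all i)) =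
    <⇒≢ i<j (trans (lookup-index (all i)) (trans (cong (lookup xs) e) (sym (lookup-index (all j)))))
... | i , i∉ = toℕ i , s≤s⁻¹ (F.toℕ<n i) , i∉

module _ {n : ℕ} where

  subset : {P : Pred (Fin n) 0ℓ} → Decidable P → List (Fin n)
  subset P? = filter P? (allFin n)

  count : {P : Pred (Fin n) 0ℓ} → Decidable P → ℕ
  count P? = length (subset P?)

  ∈-subset⁺ : {P : Pred (Fin n) 0ℓ} (P? : Decidable P) → ∀ {x} → P x → x ∈ subset P?
  ∈-subset⁺ P? {x} = ∈-filter⁺ P? (∈-allFin x)

  ∈-subset⁻ : {P : Pred (Fin n) 0ℓ} (P? : Decidable P) → ∀ {x} → x ∈ subset P? → P x
  ∈-subset⁻ P? = proj₂ ∘ ∈-filter⁻ P? {xs = allFin n}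

  count-⊎ : {P Q R : Pred (Fin n) 0ℓ} (P? : Decidable P) (Q? : Decidable Q) (R? : Decidable R) →
    (∀ {x} → P x → Q x → ⊥) → (∀ {x} → P x → R x) → (∀ {x} → Q x → R x) →
    (∀ {x} → R x → P x ⊎ Q x) → count P? + count Q? ≡ count R?
  count-⊎ P? Q? R? disj P⊆R Q⊆R R⊆ = go (allFin n)
    where
    go : ∀ xs → length (filter P? xs) + length (filter Q? xs) ≡ length (filter R? xs)
    go [] = refl
    go (x ∷ xs) with P? x | Q? x | R? x
    ... | yes p | yes q | _      = contradiction q (disj p)
    ... | yes p | no _  | yes _  = cong suc (go xs)
    ... | yes p | no _  | no ¬r  = contradiction (P⊆R p) ¬r
    ... | no _  | yes q | yes _  = trans (+-suc _ _) (cong suc (go xs))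
    ... | no _  | yes q | no ¬r  = contradiction (Q⊆R q) ¬r
    ... | no _  | no _  | no _   = go xs
    ... | no ¬p | no ¬q | yes r  = contradiction (R⊆ r) [ ¬p , ¬q ]′

  count-full : {P : Pred (Fin n) 0ℓ} (P? : Decidable P) → (∀ x → P x) → count P? ≡ n
  count-full P? all = trans (cong length (filter-all P? {xs = allFin n} (All.tabulate (λ {x} _ → all x)))) (length-tabulate (λ x → x))

  count-pos : {P : Pred (Fin n) 0ℓ} (P? : Decidable P) → ∀ {x} → P x → 1 ≤ count P?
  count-pos P? p with subset P? | ∈-subset⁺ P? p
  ... | _ ∷ _ | _ = s≤s z≤n

  count-mono : {P Q : Pred (Fin n) 0ℓ} (P? : Decidable P) (Q? : Decidable Q) →
    (∀ {x} → P x → Q x) → count P? ≤ count Q?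
  count-mono P? Q? P⊆Q = ≤-trans (m≤m+n _ _) (≤-reflexive (count-⊎ P? (λ x → Q? x ×-dec ¬? (P? x)) Q?
    (λ p q → proj₂ q p) P⊆Q proj₁ split))
    where
    split : ∀ {x} → _ → _
    split {x} q with P? x
    ... | yes p = inj₁ p
    ... | no ¬p = inj₂ (q , ¬p)

  count-strict : {P Q : Pred (Fin n) 0ℓ} (P? : Decidable P) (Q? : Decidable Q) →
    (∀ {x} → P x → Q x) → ∀ {x} → Q x → ¬ P x → count P? < count Q?
  count-strict P? Q? P⊆Q {x} q ¬p = ≤-trans
    (≤-trans (≤-reflexive (+-comm 1 _)) (+-monoʳ-≤ (count P?) (count-pos (F._≟ x) refl)))
    (≤-trans (≤-reflexive (count-⊎ P? (F._≟ x) P∪x? (λ { p refl → ¬p p }) inj₁ inj₂ (λ r → r)))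
      (count-mono P∪x? Q? (λ { (inj₁ p) → P⊆Q p ; (inj₂ refl) → q })))
    where
    P∪x? = λ y → P? y ⊎-dec (y F.≟ x)

-- Greedy colouring

module Greedy
  (I : Set) (_≟ᵢ_ : DecidableEquality I) (items : List I) (complete : ∀ p → p ∈ items)
  (Conflict : I → I → Set) (conflict-sym : ∀ {p q} → Conflict p q → Conflict q p)
  (rank : I → ℕ) (K : ℕ)
  where

  -- The colours are 0, …, K - 1; the value K stands for "not yet coloured".
  record Partial (φ : I → ℕ) : Set where
    field
      bounded : ∀ p → φ p ≤ K
      proper  : ∀ {p q} → Conflict p q → p ≢ q → φ p < K → φ p ≢ φ q

  -- In order of rank, only conflicting items of no larger rank can be coloured before `p`. Since
  -- `p` counts itself, fewer than `K` colours are forbidden.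
  Cover : I → Set
  Cover p = Σ (List I) λ L → length L ≤ K × p ∈ L ×
    (∀ q → Conflict p q → rank q ≤ rank p → q ∈ L)

  -- Some items of least rank may be coloured in advance. Least rank brings them under every
  -- `Cover`, and only the remaining items have to supply one.
  module _ {φ₀ : I → ℕ} (partial₀ : Partial φ₀)
    (early₀ : ∀ p {q} → φ₀ q < K → rank q ≤ rank p)
    (cover : ∀ p → ¬ φ₀ p < K → Cover p)
    where

    -- The invariant of the run through the ranks: `early` confines the coloured conflicts of the
    -- current item to its `Cover`, and `extends` shows that an item still uncoloured has one.
    record State (m : ℕ) (Done : I → Set) : Set where
      field
        φ       : I → ℕ
        partial : Partial φ
        early   : ∀ {q} → φ q < K → φ₀ q < K ⊎ rank q ≤ m
        done    : ∀ {q} → Done q → φ q < K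
        extends : ∀ {q} → φ₀ q < K → φ q < K

    weaken : ∀ {m m′ D D′} → m ≤ m′ → (∀ {q} → D′ q → D q) → State m D → State m′ D′
    weaken m≤ D′⊆D s = record
      { φ = φ ; partial = partial ; done = done ∘ D′⊆D ; extends = extends
      ; early = λ h → [ inj₁ , (λ r → inj₂ (≤-trans r m≤)) ]′ (early h) }
      where open State s

    insert : ∀ {m D} p → rank p ≡ m → State m D → State m (λ q → D q ⊎ q ≡ p)
    insert {m} {D} p refl s with State.φ s p <? K
    ... | yes h = record
      { φ = φ ; partial = partial ; early = early ; extends = extends
      ; done = [ done , (λ { refl → h }) ]′ }
      where open State s
    ... | no h with cover p (h ∘ State.extends s)
    ... | L , L≤K , p∈L , covers with fresh K (map (State.φ s) L) (≤-trans (≤-reflexive (length-map _ L)) L≤K)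
    ... | k , k≤K , k∉ = record
      { φ = φ′
      ; partial = record { bounded = bounded′ ; proper = proper′ }
      ; early = early′ ; done = done′ ; extends = extends′ }
      where
      open State s
      open Partial partial
      φp≡K : φ p ≡ K
      φp≡K = ≤-antisym (bounded p) (≮⇒≥ h)
      -- The uncoloured `p` belongs to `L` with value `K`, so `K` is among the avoided values and
      -- `k` is a genuine colour.
      k<K : k < K
      k<K = ≤∧≢⇒< k≤K (λ { refl → k∉ (subst (_∈ map φ L) φp≡K (∈-map⁺ φ p∈L)) })
      φ′ : I → ℕ
      φ′ q with q ≟ᵢ p
      ... | yes _ = k
      ... | no _  = φ q
      bounded′ : ∀ q → φ′ q ≤ K
      bounded′ q with q ≟ᵢ p
      ... | yes _ = k≤K
      ... | no _  = bounded q
      avoids : ∀ q → Conflict p q → k ≢ φ q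
      avoids q c e = k∉ (subst (_∈ map φ L) (sym e) (∈-map⁺ φ (covers q c
        ([ early₀ p , (λ r → r) ]′ (early (subst (_< K) e k<K))))))
      proper′ : ∀ {q r} → Conflict q r → q ≢ r → φ′ q < K → φ′ q ≢ φ′ r
      proper′ {q} {r} c ne lt with q ≟ᵢ p | r ≟ᵢ p
      ... | yes refl | yes refl = contradiction refl ne
      ... | yes refl | no _ = avoids r c
      ... | no _ | yes refl = avoids q (conflict-sym c) ∘ sym
      ... | no _ | no _ = proper c ne lt
      early′ : ∀ {q} → φ′ q < K → φ₀ q < K ⊎ rank q ≤ m
      early′ {q} lt with q ≟ᵢ p
      ... | yes refl = inj₂ ≤-refl
      ... | no _ = early lt
      grow : ∀ {q} → φ q < K → φ′ q < K
      grow {q} lt with q ≟ᵢ p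
      ... | yes refl = k<K
      ... | no _ = lt
      extends′ : ∀ {q} → φ₀ q < K → φ′ q < K
      extends′ lt = grow (extends lt)
      done′ : ∀ {q} → D q ⊎ q ≡ p → φ′ q < K
      done′ (inj₁ d) = grow (done d)
      done′ {q} (inj₂ refl) with q ≟ᵢ q
      ... | yes _ = k<K
      ... | no ne = contradiction refl ne

    level : ∀ {m D} xs → State m D → State m (λ q → D q ⊎ (q ∈ xs × rank q ≡ m))
    level [] s = weaken ≤-refl (λ { (inj₁ d) → d ; (inj₂ (() , _)) }) s
    level {m} (x ∷ xs) s with rank x ≟ m
    ... | yes e = weaken ≤-refl
      (λ { (inj₁ d) → inj₁ (inj₁ d) ; (inj₂ (here refl , _)) → inj₂ refl ; (inj₂ (there i , r)) → inj₁ (inj₂ (i , r)) })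
      (insert x e (level xs s))
    ... | no ne = weaken ≤-refl
      (λ { (inj₁ d) → inj₁ d ; (inj₂ (here refl , r)) → contradiction r ne ; (inj₂ (there i , r)) → inj₂ (i , r) })
      (level xs s)

    levels : ∀ m → State m (λ q → rank q < m)
    levels zero = record { φ = φ₀ ; partial = partial₀ ; early = inj₁ ; done = λ () ; extends = λ h → h }
    levels (suc m) = weaken (n≤1+n m) split (level items (levels m))
      where
      split : ∀ {q} → rank q < suc m → rank q < m ⊎ (q ∈ items × rank q ≡ m)
      split {q} h with m≤n⇒m<n∨m≡n (s≤s⁻¹ h)
      ... | inj₁ l = inj₁ l
      ... | inj₂ e = inj₂ (complete q , e)

    greedy : Σ (I → ℕ) λ φ → (∀ p → φ p < K) × (∀ {p q} → Conflict p q → p ≢ q → φ p ≢ φ q)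
    greedy = φ , (λ p → done (below p)) , λ {p} c ne → Partial.proper partial c ne (done (below p))
      where
      -- One past the largest rank, so that every item has been processed.
      open State (levels (suc (max 0 (map rank items))))
      below : ∀ p → rank p < suc (max 0 (map rank items))
      below p = s≤s (All.lookup (xs≤max 0 (map rank items)) (∈-map⁺ rank (complete p)))

-- Rooted trees

module _ {n : ℕ} where

  sort : Fin n → Fin n → Fin n × Fin n
  sort x y with x F.<? y
  ... | yes _ = x , y
  ... | no  _ = y , x

  sort-< : ∀ {x y} → x F.< y → sort x y ≡ (x , y)
  sort-< {x} {y} h with x F.<? y
  ... | yes _ = refl
  ... | no ¬h = contradiction h ¬h

  sort-> : ∀ {x y} → x F.< y → sort y x ≡ (x , y)
  sort-> {x} {y} h with y F.<? x
  ... | yes h′ = contradiction h′ (<-asym h)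
  ... | no _ = refl

  cross : List (Fin n) → List (Fin n) → List (Fin n × Fin n)
  cross A B = map (uncurry sort) (cartesianProduct A B)

  length-cross : ∀ A B → length (cross A B) ≡ length A * length B
  length-cross A B = trans (length-map (uncurry sort) (cartesianProduct A B)) (length-cartesianProduct A B)

  Ends : Fin n × Fin n → Fin n → Fin n → Set
  Ends p z z′ = p ≡ (z , z′) ⊎ p ≡ (z′ , z)

  ∈-cross⁺ : ∀ {A B p z z′} → proj₁ p F.< proj₂ p → Ends p z z′ → z ∈ A → z′ ∈ B → p ∈ cross A B
  ∈-cross⁺ {A} {B} h (inj₁ refl) z∈ z′∈ = subst (_∈ cross A B) (sort-< h) (∈-map⁺ (uncurry sort) (∈-cartesianProduct⁺ z∈ z′∈))
  ∈-cross⁺ {A} {B} h (inj₂ refl) z∈ z′∈ = subst (_∈ cross A B) (sort-> h) (∈-map⁺ (uncurry sort) (∈-cartesianProduct⁺ z∈ z′∈))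

-- The tree enters only through a parent map and a depth. An edge is represented by its lower end, a
-- vertex other than `c`.
module Rooted {n : ℕ} (c : Fin n) (par : Fin n → Fin n) (dep : Fin n → ℕ)
  (dep-par : ∀ {x} → x ≢ c → dep x ≡ suc (dep (par x))) where

  infix 4 _⊑_ _⊑?_

  -- x ⊑ w : the vertex w lies on the way from x to the root.
  data _⊑_ (x : Fin n) : Fin n → Set where
    done : x ⊑ x
    up   : ∀ {w} → x ≢ c → par x ⊑ w → x ⊑ w

  dep-par< : ∀ {x} → x ≢ c → dep (par x) < dep x
  dep-par< x≢c = ≤-reflexive (sym (dep-par x≢c))

  ⊑-trans : ∀ {x y z} → x ⊑ y → y ⊑ z → x ⊑ z
  ⊑-trans done      q = q
  ⊑-trans (up ne p) q = up ne (⊑-trans p q)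

  ⊑-dep : ∀ {x y} → x ⊑ y → dep y ≤ dep x
  ⊑-dep done      = ≤-refl
  ⊑-dep (up ne p) = ≤-trans (⊑-dep p) (<⇒≤ (dep-par< ne))

  ⋢-child : ∀ {w} → w ≢ c → ¬ par w ⊑ w
  ⋢-child w≢c h = <⇒≱ (dep-par< w≢c) (⊑-dep h)

  dep-induction : (P : Fin n → Set) → (∀ x → (x ≢ c → P (par x)) → P x) → ∀ x → P x
  dep-induction P f x = go (dep x) x refl
    where
    go : ∀ d x → dep x ≡ d → P x
    -- A vertex other than the root has positive depth, so there is no call to the parent here.
    go zero    x e = f x (λ ne → contradiction (trans (sym (dep-par ne)) e) λ ())
    go (suc d) x e = f x (λ ne → go d (par x) (suc-injective (trans (sym (dep-par ne)) e)))

  _⊑?_ : ∀ x w → Dec (x ⊑ w)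
  x ⊑? w = dep-induction (λ x → Dec (x ⊑ w)) decide x
    where
    decide : ∀ x → (x ≢ c → Dec (par x ⊑ w)) → Dec (x ⊑ w)
    decide x rec with x F.≟ w
    ... | yes refl = yes done
    ... | no x≢w with x F.≟ c
    ... | yes x≡c = no λ { done → x≢w refl ; (up ne _) → ne x≡c }
    ... | no x≢c with rec x≢c
    ... | yes p = yes (up x≢c p)
    ... | no ¬p = no λ { done → x≢w refl ; (up _ p) → ¬p p }

  ⊑-root : ∀ x → x ⊑ c
  ⊑-root = dep-induction (_⊑ c) climb
    where
    climb : ∀ x → (x ≢ c → par x ⊑ c) → x ⊑ c
    climb x rec with x F.≟ c
    ... | yes refl = done
    ... | no ne = up ne (rec ne)

  root-⊑ : ∀ {e} → c ⊑ e → e ≡ c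
  root-⊑ done      = refl
  root-⊑ (up ne _) = contradiction refl ne

  ⊑-chain : ∀ {x e f} → x ⊑ e → x ⊑ f → e ⊑ f ⊎ f ⊑ e
  ⊑-chain done     q        = inj₁ q
  ⊑-chain p        done     = inj₂ p
  ⊑-chain (up _ p) (up _ q) = ⊑-chain p q

  child-below : ∀ {x v} → x ⊑ v → x ≡ v ⊎ ∃ λ w → x ⊑ w × w ≢ c × par w ≡ v
  child-below done = inj₁ refl
  child-below {x} (up ne p) with child-below p
  ... | inj₁ e = inj₂ (x , done , ne , e)
  ... | inj₂ (w , q , r) = inj₂ (w , up ne q , r)

  siblings-⊑ : ∀ {w w′} → w′ ≢ c → par w ≡ par w′ → w ⊑ w′ → w ≡ w′
  siblings-⊑ _ _ done = refl
  siblings-⊑ w′≢c e (up _ p) = contradiction (subst (_⊑ _) e p) (⋢-child w′≢c)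

  siblings-unique : ∀ {x w w′} → w ≢ c → w′ ≢ c → par w ≡ par w′ → x ⊑ w → x ⊑ w′ → w ≡ w′
  siblings-unique w≢c w′≢c e p q with ⊑-chain p q
  ... | inj₁ h = siblings-⊑ w′≢c e h
  ... | inj₂ h = sym (siblings-⊑ w≢c (sym e) h)

  LCA : Fin n → Fin n → Fin n → Set
  LCA x y v = x ⊑ v × y ⊑ v × (∀ {e} → x ⊑ e → y ⊑ e → v ⊑ e)

  -- Climb from `x` to the first vertex that has `y` below it. The vertices passed on the way are no
  -- common ancestors, so leastness survives each step down.
  lcas : ∀ y x → ∃ (LCA x y)
  lcas y = dep-induction (λ x → ∃ (LCA x y)) climb
    where
    climb : ∀ x → (x ≢ c → ∃ (LCA (par x) y)) → ∃ (LCA x y)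
    climb x rec with y ⊑? x
    ... | yes h = x , done , h , λ p _ → p
    ... | no ¬h with rec (λ { refl → ¬h (⊑-root y) })
    ... | v , p , q , least = v , up (λ { refl → ¬h (⊑-root y) }) p , q ,
          λ { done h → contradiction h ¬h ; (up _ r) s → least r s }

  lca : Fin n → Fin n → Fin n
  lca x y = proj₁ (lcas y x)

  rank : Fin n × Fin n → ℕ
  rank (x , y) = dep (lca x y)

  size cosize : Fin n → ℕ
  size   w = count (_⊑? w)
  cosize w = count (λ x → ¬? (x ⊑? w))

  size+cosize : ∀ w → size w + cosize w ≡ n
  size+cosize w = trans (count-⊎ (_⊑? w) (λ x → ¬? (x ⊑? w)) (λ x → (x ⊑? w) ⊎-dec ¬? (x ⊑? w))
      (λ p ¬p → ¬p p) inj₁ inj₂ (λ r → r))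
    (count-full (λ x → (x ⊑? w) ⊎-dec ¬? (x ⊑? w)) em)
    where
    em : ∀ x → x ⊑ w ⊎ ¬ x ⊑ w
    em x with x ⊑? w
    ... | yes p = inj₁ p
    ... | no ¬p = inj₂ ¬p

  -- For `e ≢ c` this expresses that the path between the ends of `p` uses the edge from `e` to its
  -- parent; `onPath⇒sep` and `sep⇒onPath` below establish this.
  Sep : Fin n → Fin n × Fin n → Set
  Sep e p = ∃₂ λ z z′ → Ends p z z′ × z ⊑ e × ¬ z′ ⊑ e

  Conflict : Fin n × Fin n → Fin n × Fin n → Set
  Conflict p@(x , y) q@(x′ , y′) = x F.< y × x′ F.< y′ × ∃ λ e → e ≢ c × Sep e p × Sep e q

  conflict-sym : ∀ {p q} → Conflict p q → Conflict q p
  conflict-sym (h , h′ , e , ne , s , s′) = h′ , h , e , ne , s′ , s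

  crossing : Fin n → List (Fin n × Fin n)
  crossing w = cross (subset (_⊑? w)) (subset (λ x → ¬? (x ⊑? w)))

  length-crossing : ∀ w → length (crossing w) ≡ size w * cosize w
  length-crossing w = length-cross (subset (_⊑? w)) _

  sep⇒∈crossing : ∀ {w p} → proj₁ p F.< proj₂ p → Sep w p → p ∈ crossing w
  sep⇒∈crossing {w} h (_ , _ , ends , z⊑w , z′⋢w) =
    ∈-cross⁺ h ends (∈-subset⁺ (_⊑? w) z⊑w) (∈-subset⁺ (λ x → ¬? (x ⊑? w)) z′⋢w)

  module _ {w w′ : Fin n} (disjoint : ∀ {z} → z ⊑ w → z ⊑ w′ → ⊥) where

    outside? : ∀ z → Dec (¬ z ⊑ w × ¬ z ⊑ w′)
    outside? z = ¬? (z ⊑? w) ×-dec ¬? (z ⊑? w′)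

    union? : ∀ z → Dec (z ⊑ w ⊎ z ⊑ w′)
    union? z = (z ⊑? w) ⊎-dec (z ⊑? w′)

    count-union : size w + size w′ ≡ count union?
    count-union = count-⊎ (_⊑? w) (_⊑? w′) union? disjoint inj₁ inj₂ (λ r → r)

    count-partition : size w + size w′ + count outside? ≡ n
    count-partition = trans (cong (_+ count outside?) count-union)
      (trans (count-⊎ union? outside? (λ z → union? z ⊎-dec outside? z)
               (λ { (inj₁ p) (q , _) → q p ; (inj₂ p) (_ , q) → q p }) inj₁ inj₂ (λ r → r))
        (count-full (λ z → union? z ⊎-dec outside? z) em))
      where
      em : ∀ z → (z ⊑ w ⊎ z ⊑ w′) ⊎ (¬ z ⊑ w × ¬ z ⊑ w′)
      em z with z ⊑? w | z ⊑? w′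
      ... | yes p | _     = inj₁ (inj₁ p)
      ... | no _  | yes p = inj₁ (inj₂ p)
      ... | no ¬p | no ¬q = inj₂ (¬p , ¬q)

    -- The blocks of the bound XY + Xr + Yr. A pair separated by both edges belongs to the first
    -- block alone.
    crossings : List (Fin n × Fin n)
    crossings = cross (subset (_⊑? w)) (subset (_⊑? w′)) ++
      (cross (subset (_⊑? w)) (subset outside?) ++ cross (subset (_⊑? w′)) (subset outside?))

    length-crossings : length crossings ≡ size w * size w′ + size w * count outside? + size w′ * count outside?
    length-crossings = trans (length-++ (cross (subset (_⊑? w)) (subset (_⊑? w′))))
      (trans (cong₂ _+_ (length-cross (subset (_⊑? w)) _)
               (trans (length-++ (cross (subset (_⊑? w)) (subset outside?)))
                 (cong₂ _+_ (length-cross (subset (_⊑? w)) _) (length-cross (subset (_⊑? w′)) _))))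
        (sym (+-assoc (size w * size w′) _ _)))

    sep⇒∈crossings : ∀ {p} → proj₁ p F.< proj₂ p → Sep w p ⊎ Sep w′ p → p ∈ crossings
    sep⇒∈crossings h (inj₁ (z , z′ , ends , z⊑w , z′⋢w)) with z′ ⊑? w′
    ... | yes r = ∈-++⁺ˡ (∈-cross⁺ h ends (∈-subset⁺ (_⊑? w) z⊑w) (∈-subset⁺ (_⊑? w′) r))
    ... | no ¬r = ∈-++⁺ʳ (cross (subset (_⊑? w)) (subset (_⊑? w′)))
            (∈-++⁺ˡ (∈-cross⁺ h ends (∈-subset⁺ (_⊑? w) z⊑w) (∈-subset⁺ outside? (z′⋢w , ¬r))))
    sep⇒∈crossings h (inj₂ (z , z′ , ends , z⊑w′ , z′⋢w′)) with z′ ⊑? w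
    ... | yes r = ∈-++⁺ˡ (∈-cross⁺ h (swap ends) (∈-subset⁺ (_⊑? w) r) (∈-subset⁺ (_⊑? w′) z⊑w′))
    ... | no ¬r = ∈-++⁺ʳ (cross (subset (_⊑? w)) (subset (_⊑? w′)))
            (∈-++⁺ʳ (cross (subset (_⊑? w)) (subset outside?))
              (∈-cross⁺ h ends (∈-subset⁺ (_⊑? w′) z⊑w′) (∈-subset⁺ outside? (¬r , z′⋢w′))))

  -- A proper ancestor of `w` lies above `v`, hence above `y`, so its edge cannot separate `x` from
  -- `y`.
  low-edge-below : ∀ {x y v w e} → y ⊑ v → par w ≡ v → x ⊑ w → x ⊑ e → ¬ y ⊑ e → e ⊑ w
  low-edge-below y⊑v refl x⊑w x⊑e y⋢e with ⊑-chain x⊑e x⊑w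
  ... | inj₁ h        = h
  ... | inj₂ done     = done
  ... | inj₂ (up _ h) = contradiction (⊑-trans y⊑v h) y⋢e

  -- Here the order of colouring matters. If both ends of `q` were below `w`, their lowest common
  -- ancestor would be too, and it would be deeper than `v`.
  sep-transfer : ∀ {e w v} q → w ≢ c → par w ≡ v → e ⊑ w → Sep e q → rank q ≤ dep v → Sep w q
  sep-transfer {e} {w} q@(x′ , y′) w≢c refl e⊑w (z , z′ , ends , z⊑e , _) r =
    z , z′ , ends , ⊑-trans z⊑e e⊑w , λ z′⊑w →
      <⇒≱ (dep-par< w≢c) (≤-trans (⊑-dep (lca⊑ ends (⊑-trans z⊑e e⊑w) z′⊑w)) r)
    where
    lca⊑ : ∀ {z z′} → Ends q z z′ → z ⊑ w → z′ ⊑ w → lca x′ y′ ⊑ w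
    lca⊑ (inj₁ refl) p p′ = proj₂ (proj₂ (proj₂ (lcas y′ x′))) p p′
    lca⊑ (inj₂ refl) p p′ = proj₂ (proj₂ (proj₂ (lcas y′ x′))) p′ p

  branches : ∀ x → x ≡ c ⊎ ∃ λ w → x ⊑ w × w ≢ c × par w ≡ c
  branches x = child-below (⊑-root x)

  -- A branch at the root is named by its top vertex; the value `c` at the root is a default.
  branch : Fin n → Fin n
  branch x = [ (λ _ → c) , proj₁ ]′ (branches x)

  branch-spec : ∀ {x} → x ≢ c → x ⊑ branch x × branch x ≢ c × par (branch x) ≡ c
  branch-spec {x} ne with branches x
  ... | inj₁ e = contradiction e ne
  ... | inj₂ (_ , spec) = spec

  branch-unique : ∀ {x w} → x ⊑ w → w ≢ c → par w ≡ c → branch x ≡ w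
  branch-unique {x} x⊑w w≢c e = siblings-unique b≢c w≢c (trans eb (sym e)) x⊑b x⊑w
    where
    x≢c : x ≢ c
    x≢c refl = w≢c (root-⊑ x⊑w)
    x⊑b = proj₁ (branch-spec x≢c)
    b≢c = proj₁ (proj₂ (branch-spec x≢c))
    eb = proj₂ (proj₂ (branch-spec x≢c))

  branch-⊑ : ∀ {x e} → x ⊑ e → e ≢ c → branch x ≡ branch e
  branch-⊑ x⊑e e≢c with branch-spec e≢c
  ... | e⊑b , b≢c , pb = branch-unique (⊑-trans x⊑e e⊑b) b≢c pb

  -- The paths that have `c` as an inner vertex.
  Flat : Fin n × Fin n → Set
  Flat (x , y) = x ≢ c × y ≢ c × branch x ≢ branch y

  -- Colouring the paths of a rooted tree

  module Colouring (a b K : ℕ) (a+b≡n : a + b ≡ n) (a≤b : a ≤ b) (1≤a : 1 ≤ a)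
    (branch-size : ∀ {w} → w ≢ c → par w ≡ c → size w ≤ a)
    (fits : ∀ f → 2 * f < 3 * (a * b) → f ≤ K) where

    items : List (Fin n × Fin n)
    items = cartesianProduct (allFin n) (allFin n)

    complete : ∀ p → p ∈ items
    complete (x , y) = ∈-cartesianProduct⁺ (∈-allFin x) (∈-allFin y)

    open Greedy (Fin n × Fin n) (≡-dec F._≟_ F._≟_) items complete Conflict conflict-sym rank K

    size≤a : ∀ {w} → w ≢ c → size w ≤ a
    size≤a {w} w≢c with branch-spec w≢c
    ... | w⊑b , b≢c , pb = ≤-trans (count-mono (_⊑? w) (_⊑? branch w) (λ p → ⊑-trans p w⊑b)) (branch-size b≢c pb)

    1≤ab : 1 ≤ a * b
    1≤ab = *-mono-≤ 1≤a (≤-trans 1≤a a≤b)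

    crossing-fits : ∀ {w} → w ≢ c → length (crossing w) ≤ K
    crossing-fits {w} w≢c = fits _ (≤-<-trans
      (*-monoʳ-≤ 2 (≤-trans (≤-reflexive (length-crossing w))
        (product-mono {a} {b} (trans (size+cosize w) (sym a+b≡n)) (size≤a w≢c) a≤b)))
      (m<n+m (2 * (a * b)) 1≤ab))

    ends-match : ∀ {p : Fin n × Fin n} {z z′ s s′} → Ends p z z′ → Ends p s s′ → (s ≡ z × s′ ≡ z′) ⊎ (s ≡ z′ × s′ ≡ z)
    ends-match (inj₁ refl) (inj₁ refl) = inj₁ (refl , refl)
    ends-match (inj₁ refl) (inj₂ refl) = inj₂ (refl , refl)
    ends-match (inj₂ refl) (inj₁ refl) = inj₂ (refl , refl)
    ends-match (inj₂ refl) (inj₂ refl) = inj₁ (refl , refl)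

    -- A path ending at its topmost vertex reaches it through the edge at `w`. Every earlier
    -- conflicting path uses that edge as well, so the load of one edge suffices.
    cover-vertical : ∀ {p z w} → proj₁ p F.< proj₂ p → Ends p z (par w) → rank p ≡ dep (par w) →
      z ⊑ w → w ≢ c → Cover p
    cover-vertical {p} {z} {w} p< ends e z⊑w w≢c =
      crossing w , crossing-fits w≢c , sep⇒∈crossing p< (z , par w , ends , z⊑w , ⋢-child w≢c) , covers
      where
      covers : ∀ q → Conflict p q → rank q ≤ rank p → q ∈ crossing w
      covers q (_ , q< , f , _ , (s , s′ , ends′ , s⊑f , s′⋢f) , sepq) r with ends-match ends ends′
      ... | inj₁ (refl , refl) = sep⇒∈crossing q<
              (sep-transfer q w≢c refl (low-edge-below done refl z⊑w s⊑f s′⋢f) sepq (subst (rank q ≤_) e r))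
      ... | inj₂ (refl , refl) = contradiction (⊑-trans z⊑w (up w≢c s⊑f)) s′⋢f

    cover-bent : ∀ {x y w w′} → x F.< y → rank (x , y) ≡ dep (par w) → par w′ ≡ par w →
      x ⊑ w → y ⊑ w′ → w ≢ c → w′ ≢ c → w ≢ w′ → (par w ≡ c → a + b < 3 * a) → Cover (x , y)
    cover-bent {x} {y} {w} {w′} x<y e pw′ x⊑w y⊑w′ w≢c w′≢c w≢w′ flat =
      crossings disjoint , fits _ (subst (λ l → 2 * l < 3 * (a * b)) (sym (length-crossings disjoint)) bound) ,
      sep⇒∈crossings disjoint x<y (inj₁ (x , y , inj₁ refl , x⊑w , λ y⊑w → disjoint y⊑w y⊑w′)) , covers
      where
      disjoint : ∀ {z} → z ⊑ w → z ⊑ w′ → ⊥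
      disjoint p q = w≢w′ (siblings-unique w≢c w′≢c (sym pw′) p q)
      y⊑v : y ⊑ par w
      y⊑v = ⊑-trans y⊑w′ (up w′≢c (subst (_⊑ par w) (sym pw′) done))
      part : size w + size w′ + count (outside? disjoint) ≡ a + b
      part = trans (count-partition disjoint) (sym a+b≡n)
      bound : 2 * (size w * size w′ + size w * count (outside? disjoint) + size w′ * count (outside? disjoint)) < 3 * (a * b)
      bound with par w F.≟ c
      ... | yes v≡c = central-bound a b (size w) (size w′) (count (outside? disjoint)) part a≤b (flat v≡c)
      -- The vertex `par w` lies in neither child subtree, which makes the inequality strict.
      ... | no v≢c = low-bound a b (size w) (size w′) (count (outside? disjoint)) part a≤b
            (subst (_< a) (sym (count-union disjoint)) (<-≤-trans
              (count-strict (union? disjoint) (_⊑? par w)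
                (λ { (inj₁ p) → ⊑-trans p (up w≢c done) ; (inj₂ p) → ⊑-trans p (up w′≢c (subst (_⊑ par w) (sym pw′) done)) })
                done
                (λ { (inj₁ p) → ⋢-child w≢c p ; (inj₂ p) → ⋢-child w′≢c (subst (_⊑ w′) (sym pw′) p) }))
              (size≤a v≢c)))
      covers : ∀ q → Conflict (x , y) q → rank q ≤ rank (x , y) → q ∈ crossings disjoint
      covers q (_ , q< , f , _ , (s , s′ , ends , s⊑f , s′⋢f) , sepq) r = sep⇒∈crossings disjoint q< (side ends)
        where
        side : Ends (x , y) s s′ → Sep w q ⊎ Sep w′ q
        side (inj₁ refl) = inj₁ (sep-transfer q w≢c refl (low-edge-below y⊑v refl x⊑w s⊑f s′⋢f) sepq (subst (rank q ≤_) e r))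
        side (inj₂ refl) = inj₂ (sep-transfer q w′≢c pw′ (low-edge-below (⊑-trans x⊑w (up w≢c done)) pw′ y⊑w′ s⊑f s′⋢f) sepq
          (subst (rank q ≤_) e r))

    -- The premise on `Flat` serves both regimes: it is vacuous where the flat paths are coloured in
    -- advance, and otherwise 3a > n supplies its conclusion.
    cover : ∀ p → (Flat p → a + b < 3 * a) → Cover p
    cover (x , y) flat with x F.<? y
    -- Pairs not in increasing order conflict with nothing, so a singleton suffices.
    ... | no x≮y = (x , y) ∷ [] , fits 1 (*-monoʳ-≤ 3 1≤ab) , here refl , λ _ → λ { (x<y , _) → contradiction x<y x≮y }
    ... | yes x<y with proj₂ (lcas y x)
    ... | x⊑v , y⊑v , least with child-below x⊑v | child-below y⊑v
    ... | inj₁ e | inj₁ e′ = contradiction (cong toℕ (trans e (sym e′))) (<⇒≢ x<y)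
    ... | inj₁ e | inj₂ (w , y⊑w , w≢c , pw) = cover-vertical x<y (inj₂ (cong (_, y) (trans e (sym pw)))) (cong dep (sym pw)) y⊑w w≢c
    ... | inj₂ (w , x⊑w , w≢c , pw) | inj₁ e = cover-vertical x<y (inj₁ (cong (x ,_) (trans e (sym pw)))) (cong dep (sym pw)) x⊑w w≢c
    ... | inj₂ (w , x⊑w , w≢c , pw) | inj₂ (w′ , y⊑w′ , w′≢c , pw′) =
      cover-bent x<y (cong dep (sym pw)) (trans pw′ (sym pw)) x⊑w y⊑w′ w≢c w′≢c w≢w′
        (λ v≡c → flat ((λ { refl → w≢c (root-⊑ x⊑w) }) , (λ { refl → w′≢c (root-⊑ y⊑w′) }) ,
          λ e → w≢w′ (trans (sym (branch-unique x⊑w w≢c v≡c))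
                       (trans e (branch-unique y⊑w′ w′≢c (trans pw′ (trans (sym pw) v≡c)))))))
      where
      w≢w′ : w ≢ w′
      -- A common child subtree would contain the lowest common ancestor, which is the parent of
      -- `w`.
      w≢w′ refl = ⋢-child w≢c (subst (_⊑ w) (sym pw) (least x⊑w y⊑w′))

    -- Precolouring the paths through the root

    module Initial (3a≤n : 3 * a ≤ a + b) where

      N : ℕ
      N = count (λ y → ¬? (y F.≟ c))

      N<n : N < a + b
      N<n = <-≤-trans (count-strict (λ y → ¬? (y F.≟ c)) (_⊑? c) (λ {x} _ → ⊑-root x) done (λ ne → ne refl))
        (≤-reflexive (trans (count-full (_⊑? c) ⊑-root) (sym a+b≡n)))

      -- `combine` orders lexicographically, by branch first. The positions below count smaller
      -- keys, so each branch becomes an interval.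
      key : Fin n → ℕ
      key x = toℕ (combine (branch x) x)

      before? : ∀ x y → Dec (y ≢ c × key y < key x)
      before? x y = ¬? (y F.≟ c) ×-dec (key y <? key x)

      pos : Fin n → ℕ
      pos x = count (before? x)

      pos<N : ∀ {x} → x ≢ c → pos x < N
      pos<N {x} x≢c = count-strict (before? x) (λ y → ¬? (y F.≟ c)) proj₁ x≢c (λ h → <-irrefl refl (proj₂ h))

      pos-mono : ∀ {x y} → x ≢ c → key x < key y → pos x < pos y
      pos-mono {x} {y} x≢c h = count-strict (before? x) (before? y)
        (λ { (ne , h′) → ne , <-trans h′ h }) (x≢c , h) (λ h → <-irrefl refl (proj₂ h))

      pos-injective : ∀ {x y} → x ≢ c → y ≢ c → pos x ≡ pos y → x ≡ y
      pos-injective {x} {y} x≢c y≢c e with <-cmp (key x) (key y)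
      ... | tri< h _ _ = contradiction e (<⇒≢ (pos-mono x≢c h))
      ... | tri≈ _ h _ = F.combine-injectiveʳ (branch x) x (branch y) y (F.toℕ-injective h)
      ... | tri> _ _ h = contradiction (sym e) (<⇒≢ (pos-mono y≢c h))

      -- The vertices from `x` up to just before `x′` in the order of keys all lie in the common
      -- branch. They omit `x′`, so there are fewer than `a` of them.
      pos-near : ∀ {x x′} → x ≢ c → x′ ≢ c → branch x ≡ branch x′ → pos x′ < pos x + a
      pos-near {x} {x′} x≢c x′≢c same = begin-strict
        pos x′                  ≤⟨ count-mono (before? x′) below? split ⟩
        count below?            ≡⟨ count-⊎ (before? x) between? below? (λ { (_ , h) (_ , ¬h , _) → ¬h h }) inj₁ inj₂ (λ r → r) ⟨
        pos x + count between?  <⟨ +-monoʳ-< (pos x) (count-strict between? (_⊑? branch x) within x′⊑ (λ h → <-irrefl refl (proj₂ (proj₂ h)))) ⟩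
        pos x + size (branch x) ≤⟨ +-monoʳ-≤ (pos x) (size≤a (proj₁ (proj₂ (branch-spec x≢c)))) ⟩
        pos x + a               ∎
        where
        open ≤-Reasoning
        between? : ∀ y → Dec (y ≢ c × ¬ key y < key x × key y < key x′)
        between? y = ¬? (y F.≟ c) ×-dec (¬? (key y <? key x) ×-dec (key y <? key x′))
        below? : ∀ y → Dec ((y ≢ c × key y < key x) ⊎ (y ≢ c × ¬ key y < key x × key y < key x′))
        below? y = before? x y ⊎-dec between? y
        x′⊑ : x′ ⊑ branch x
        x′⊑ = subst (x′ ⊑_) (sym same) (proj₁ (branch-spec x′≢c))
        split : ∀ {y} → y ≢ c × key y < key x′ → (y ≢ c × key y < key x) ⊎ (y ≢ c × ¬ key y < key x × key y < key x′)
        split {y} (ne , h) with key y <? key x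
        ... | yes h′ = inj₁ (ne , h′)
        ... | no ¬h′ = inj₂ (ne , ¬h′ , h)
        within : ∀ {y} → y ≢ c × ¬ key y < key x × key y < key x′ → y ⊑ branch x
        within {y} (ne , l , u) with F.<-cmp (branch y) (branch x)
        ... | tri< h _ _ = contradiction (F.combine-monoˡ-< y x h) l
        ... | tri≈ _ h _ = subst (y ⊑_) h (proj₁ (branch-spec ne))
        ... | tri> _ _ h = contradiction u (<-asym (F.combine-monoˡ-< x′ y (subst (F._< branch y) same h)))

      instance
        a-nonZero : NonZero a
        a-nonZero = >-nonZero 1≤a

      open CyclicColour a N

      Na≤K : N * a ≤ K
      Na≤K = fits _ (explicit-bound a b N 1≤a N<n 3a≤n)

      flat? : ∀ p → Dec (Flat p)
      flat? (x , y) = ¬? (x F.≟ c) ×-dec (¬? (y F.≟ c) ×-dec ¬? (branch x F.≟ branch y))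

      φ₀ : Fin n × Fin n → ℕ
      φ₀ p@(x , y) with flat? p
      ... | yes _ = colourₛ (pos x) (pos y)
      ... | no  _ = K

      flat-pos≢ : ∀ {x y} → Flat (x , y) → pos x ≢ pos y
      flat-pos≢ (x≢c , y≢c , ne) e = ne (cong branch (pos-injective x≢c y≢c e))

      φ₀-flat : ∀ {p} → Flat p → φ₀ p < K
      φ₀-flat {p} flat with flat? p
      ... | yes f@(x≢c , y≢c , ne) = <-≤-trans (colourₛ<N*a (flat-pos≢ f) (pos<N x≢c) (pos<N y≢c)) Na≤K
      ... | no ¬f = contradiction flat ¬f

      -- Below any other common ancestor both ends would lie in the same branch.
      flat-early : ∀ {q} → Flat q → lca (proj₁ q) (proj₂ q) ≡ c
      flat-early {x , y} (_ , _ , ne) with lca x y F.≟ c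
      ... | yes e = e
      ... | no v≢c with proj₂ (lcas y x)
      ... | x⊑v , y⊑v , _ = contradiction (trans (branch-⊑ x⊑v v≢c) (sym (branch-⊑ y⊑v v≢c))) ne

      early₀ : ∀ p {q} → φ₀ q < K → rank q ≤ rank p
      early₀ p {q} h with flat? q
      ... | yes f = subst (λ v → dep v ≤ rank p) (sym (flat-early f)) (⊑-dep (⊑-root _))
      ... | no _ = contradiction h (<-irrefl refl)

      -- Each path has an end below the shared edge. These two ends lie in one branch, closer than
      -- `a` by `pos-near`, whereas equal colours would put all ends at distance at least `a`.
      proper₀ : ∀ {p q} → Conflict p q → p ≢ q → φ₀ p < K → φ₀ p ≢ φ₀ q
      proper₀ {p@(x , y)} {q@(x′ , y′)} (x<y , x′<y′ , e , e≢c , (z , _ , ends , z⊑e , _) , (s , _ , ends′ , s⊑e , _)) ne lt eq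
        with flat? p | flat? q
      ... | no _ | _ = contradiction lt (<-irrefl refl)
      ... | yes _ | no _ = contradiction eq (<⇒≢ lt)
      ... | yes f@(x≢c , y≢c , _) | yes f′@(x′≢c , y′≢c , _) = [ near z≢c s≢c same , near s≢c z≢c (sym same) ]′ far
        where
        nonroot : ∀ {t} → t ⊑ e → t ≢ c
        nonroot t⊑e refl = e≢c (root-⊑ t⊑e)
        z≢c = nonroot z⊑e
        s≢c = nonroot s⊑e
        same : branch z ≡ branch s
        same = trans (branch-⊑ z⊑e e≢c) (sym (branch-⊑ s⊑e e≢c))
        near : ∀ {t t′} → t ≢ c → t′ ≢ c → branch t ≡ branch t′ → ¬ pos t + a ≤ pos t′
        near h h′ e = <⇒≱ (pos-near h h′ e)
        distinct : ¬ ((pos x ≡ pos x′ × pos y ≡ pos y′) ⊎ (pos x ≡ pos y′ × pos y ≡ pos x′))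
        distinct (inj₁ (i , j)) = ne (cong₂ _,_ (pos-injective x≢c x′≢c i) (pos-injective y≢c y′≢c j))
        distinct (inj₂ (i , j)) with pos-injective x≢c y′≢c i | pos-injective y≢c x′≢c j
        -- Both pairs are in increasing order, so one cannot be the reverse of the other.
        ... | refl | refl = <-asym x<y x′<y′
        all : AllFar a (pos x) (pos y) (pos x′) (pos y′)
        all = colourₛ-far (flat-pos≢ f) (pos<N x≢c) (pos<N y≢c) (flat-pos≢ f′) (pos<N x′≢c) (pos<N y′≢c) distinct eq
        pick : ∀ {z s z′ s′} → Ends p z z′ → Ends q s s′ → Far a (pos z) (pos s)
        pick (inj₁ refl) (inj₁ refl) = proj₁ (proj₁ all)
        pick (inj₁ refl) (inj₂ refl) = proj₂ (proj₁ all)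
        pick (inj₂ refl) (inj₁ refl) = proj₁ (proj₂ all)
        pick (inj₂ refl) (inj₂ refl) = proj₂ (proj₂ all)
        far = pick ends ends′

      bounded₀ : ∀ p → φ₀ p ≤ K
      bounded₀ p with flat? p
      ... | yes f@(x≢c , y≢c , _) = <⇒≤ (<-≤-trans (colourₛ<N*a (flat-pos≢ f) (pos<N x≢c) (pos<N y≢c)) Na≤K)
      ... | no _ = ≤-refl

    colouring : Σ (Fin n × Fin n → ℕ) λ φ → (∀ p → φ p < K) × (∀ {p q} → Conflict p q → p ≢ q → φ p ≢ φ q)
    colouring with 3 * a ≤? a + b
    ... | yes h = greedy record { bounded = bounded₀ ; proper = proper₀ } early₀
            (λ p ¬φ₀ → cover p (λ flat → contradiction (φ₀-flat flat) ¬φ₀))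
      where open Initial h
    ... | no h = greedy {φ₀ = λ _ → K} record { bounded = λ _ → ≤-refl ; proper = λ _ _ lt → contradiction lt (<-irrefl refl) }
            (λ _ lt → contradiction lt (<-irrefl refl)) (λ p _ → cover p (λ _ → ≰⇒> h))

-- Trees as graphs

module _ {n : ℕ} where

  Conn : SimpleGraph n → Fin n → Fin n → Set
  Conn G x y = ∃ (Walk G x y)

  module _ {G : SimpleGraph n} where

    conn-refl : ∀ {x} → Conn G x x
    conn-refl = _ , here

    conn-step : ∀ {x z y} → Adj G x z → Conn G z y → Conn G x y
    conn-step a (_ , w) = _ , step a w

    conn-trans : ∀ {x y z} → Conn G x y → Conn G y z → Conn G x z
    conn-trans (_ , here)     q = q
    conn-trans (_ , step a w) q = conn-step a (conn-trans (_ , w) q)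

    conn-sym : ∀ {x y} → Conn G x y → Conn G y x
    conn-sym (_ , here)     = conn-refl
    conn-sym (_ , step a w) = conn-trans (conn-sym (_ , w)) (conn-step (symmetric G a) conn-refl)

    path-suffix : ∀ {x y z vs} → IsPath G z y vs → x ∈ vs → ∃ (IsPath G x y)
    path-suffix (here , u)         (here refl) = _ , here , u
    path-suffix (step a w , u)     (here refl) = _ , step a w , u
    path-suffix (step a w , _ ∷ u) (there i)   = path-suffix (w , u) i

    -- If the new first vertex recurs in the path already found, the detour before its recurrence is
    -- cut off.
    conn⇒path : ∀ {x y} → Conn G x y → ∃ (IsPath G x y)
    conn⇒path (_ , here) = _ , here , (All.[] ∷ [])
    conn⇒path {x} (_ , step a w) with conn⇒path (_ , w)
    ... | vs , p , u with DecMembership._∈?_ F._≟_ x vs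
    ... | yes x∈ = path-suffix (p , u) x∈
    ... | no x∉ = _ , step a p , (¬Any⇒All¬ vs x∉ ∷ u)

    end∈ : ∀ {x y vs} → Walk G x y vs → y ∈ vs
    end∈ here       = here refl
    end∈ (step _ w) = there (end∈ w)

    first-edge : ∀ {x z y vs} → Walk G z y vs → Consec x z (x ∷ vs)
    first-edge here       = here
    first-edge (step _ _) = here

  conn-map : ∀ {G H : SimpleGraph n} → (∀ {x y} → Adj G x y → Adj H x y) → ∀ {x y} → Conn G x y → Conn H x y
  conn-map f (_ , here)     = conn-refl
  conn-map f (_ , step a w) = conn-step (f a) (conn-map f (_ , w))

  consec∈ : ∀ {u v : Fin n} {vs} → Consec u v vs → u ∈ vs × v ∈ vs
  consec∈ here      = here refl , there (here refl)
  consec∈ (there c) = there (proj₁ (consec∈ c)) , there (proj₂ (consec∈ c))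

  consec? : ∀ (u v : Fin n) vs → Dec (Consec u v vs)
  consec? u v []       = no λ ()
  consec? u v (x ∷ []) = no λ { (there ()) }
  consec? u v (x ∷ y ∷ vs) with x F.≟ u | y F.≟ v | consec? u v (y ∷ vs)
  ... | yes refl | yes refl | _     = yes here
  ... | _        | _        | yes c = yes (there c)
  ... | no ne    | _        | no ¬c = no λ { here → ne refl ; (there c) → ¬c c }
  ... | yes _    | no ne    | no ¬c = no λ { here → ne refl ; (there c) → ¬c c }

  SameEdge : (x y u v : Fin n) → Set
  SameEdge x y u v = (x ≡ u × y ≡ v) ⊎ (x ≡ v × y ≡ u)

  sameEdge? : ∀ x y u v → Dec (SameEdge x y u v)
  sameEdge? x y u v = ((x F.≟ u) ×-dec (y F.≟ v)) ⊎-dec ((x F.≟ v) ×-dec (y F.≟ u))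

  delete : SimpleGraph n → Fin n → Fin n → SimpleGraph n
  delete G u v = record
    { Adj       = λ x y → Adj G x y × ¬ SameEdge x y u v
    ; symmetric = λ { (a , ne) → symmetric G a , λ { (inj₁ (p , q)) → ne (inj₂ (q , p)) ; (inj₂ (p , q)) → ne (inj₁ (q , p)) } }
    ; loopless  = loopless G ∘ proj₁ }

  delete-comm : ∀ {G : SimpleGraph n} {u v x y} → Conn (delete G u v) x y → Conn (delete G v u) x y
  delete-comm = conn-map (λ { (a , ne) → a , ne ∘ swap })

  module _ {G : SimpleGraph n} {u v : Fin n} where

    walk-avoiding : ∀ {x y vs} → Walk G x y vs → ¬ Consec u v vs → ¬ Consec v u vs → Conn (delete G u v) x y
    walk-avoiding here _ _ = conn-refl
    walk-avoiding (step a w) ¬c ¬c′ = conn-step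
      (a , λ { (inj₁ (refl , refl)) → ¬c (first-edge w) ; (inj₂ (refl , refl)) → ¬c′ (first-edge w) })
      (walk-avoiding w (¬c ∘ there) (¬c′ ∘ there))

    -- A path visits no vertex twice, so the parts before and after the edge do not use it again.
    consec⇒sides : ∀ {x y vs} → IsPath G x y vs → Consec u v vs → Conn (delete G u v) x u × Conn (delete G u v) v y
    consec⇒sides (step a w , u∉ ∷ _) here with w
    ... | here = conn-refl , conn-refl
    ... | step b w′ = conn-refl , walk-avoiding (step b w′) (absent ∘ proj₁ ∘ consec∈) (absent ∘ proj₂ ∘ consec∈)
      where absent = All¬⇒¬Any u∉
    consec⇒sides (step a w , x∉ ∷ uq) (there c) with consec⇒sides (w , uq) c
    ... | p , q = conn-step (a , λ { (inj₁ (refl , _)) → All¬⇒¬Any x∉ (proj₁ (consec∈ c))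
                                   ; (inj₂ (refl , _)) → All¬⇒¬Any x∉ (proj₂ (consec∈ c)) }) p , q

  onPath-sym : ∀ {G : SimpleGraph n} {u v x y} → OnPath G u v x y → OnPath G v u x y
  onPath-sym (vs , p , c) = vs , p , swap c

-- Edges of a tree as cuts

module Tree {n : ℕ} (T : SimpleGraph n) (tree : IsTree T) where

  module _ {u v : Fin n} (uv : Adj T u v) where

    -- A path that avoids the edge would close up with it to a cycle; paths on one or two vertices
    -- are excluded separately.
    bridge : ¬ Conn (delete T u v) u v
    bridge conn with conn⇒path conn
    ... | _ , here , _ = loopless T uv
    ... | _ , step (_ , ne) here , _ = ne (inj₁ (refl , refl))
    ... | vs , w@(step _ (step _ _)) , uq = proj₂ tree vs (u , v , (walk-map w , uq) , symmetric T uv , long w)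
      where
      walk-map : ∀ {x y vs} → Walk (delete T u v) x y vs → Walk T x y vs
      walk-map here             = here
      walk-map (step (a , _) w) = step a (walk-map w)
      long : ∀ {vs} → Walk (delete T u v) u v vs → 3 ≤ length vs
      long here = contradiction uv (loopless T)
      long (step (_ , ne) here) = contradiction (inj₁ (refl , refl)) ne
      long (step _ (step _ here)) = s≤s (s≤s (s≤s z≤n))
      long (step _ (step _ (step _ _))) = s≤s (s≤s (s≤s z≤n))

    -- Follow a walk from `x` to `u` until it first meets the edge, which happens at `u` or at `v`.
    sides : ∀ x → Conn (delete T u v) x u ⊎ Conn (delete T u v) x v
    sides x = go (proj₂ (proj₁ tree x u))
      where
      go : ∀ {x vs} → Walk T x u vs → Conn (delete T u v) x u ⊎ Conn (delete T u v) x v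
      go here = inj₁ conn-refl
      go (step {x} {z} a w) with sameEdge? x z u v
      ... | yes (inj₁ (refl , _)) = inj₁ conn-refl
      ... | yes (inj₂ (refl , _)) = inj₂ conn-refl
      ... | no ne = [ inj₁ ∘ conn-step (a , ne) , inj₂ ∘ conn-step (a , ne) ]′ (go w)

    separated⇒consec : ∀ {x y vs} → Walk T x y vs → Conn (delete T u v) x u → Conn (delete T u v) v y →
      Consec u v vs ⊎ Consec v u vs
    separated⇒consec {vs = vs} w xu vy with consec? u v vs | consec? v u vs
    ... | yes c | _     = inj₁ c
    ... | no _  | yes c = inj₂ c
    ... | no ¬c | no ¬c′ = contradiction
      (conn-trans (conn-sym xu) (conn-trans (walk-avoiding w ¬c ¬c′) (conn-sym vy))) bridge

  -- The first edge of one path separates the ends, so the other path uses it too, and must do so at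
  -- once because `x` does not recur.
  path-unique : ∀ {x y vs vs′} → IsPath T x y vs → IsPath T x y vs′ → vs ≡ vs′
  path-unique (here , _) (here , _) = refl
  path-unique (here , _) (step _ w , x∉ ∷ _) = contradiction (end∈ w) (All¬⇒¬Any x∉)
  path-unique (step _ w , x∉ ∷ _) (here , _) = contradiction (end∈ w) (All¬⇒¬Any x∉)
  path-unique {x} p@(step {z = z} a w , _ ∷ u) (step a′ w′ , x∉ ∷ u′)
    with separated⇒consec a (step a′ w′) conn-refl (proj₂ (consec⇒sides p (first-edge w)))
  ... | inj₁ (there c) = contradiction (proj₁ (consec∈ c)) (All¬⇒¬Any x∉)
  ... | inj₂ (there c) = contradiction (proj₂ (consec∈ c)) (All¬⇒¬Any x∉)
  ... | inj₂ here      = contradiction a (loopless T)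
  ... | inj₁ here with w′
  ...   | here     = cong (x ∷_) (path-unique (w , u) (here , u′))
  ...   | step b v = cong (x ∷_) (path-unique (w , u) (step b v , u′))

  load-unique : ∀ {u v m m′} → Load T u v m → Load T u v m′ → m ≡ m′
  load-unique (l , uq , iff , refl) (l′ , uq′ , iff′ , refl) = ↭-length (∼bag⇒↭ (unique∧set⇒bag uq uq′ (λ {p} →
    mk⇔ (Equivalence.from (iff′ p) ∘ Equivalence.to (iff p)) (Equivalence.from (iff p) ∘ Equivalence.to (iff′ p)))))

  load-sym : ∀ {u v m} → Load T u v m → Load T v u m
  load-sym {u} {v} (l , uq , iff , e) = l , uq , (λ p → mk⇔
    (λ i → let h , o = Equivalence.to (iff p) i in h , onPath-sym {G = T} {u} {v} o)
    (λ { (h , o) → Equivalence.from (iff p) (h , onPath-sym {G = T} {v} {u} o) })) , e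

  -- Rooting a tree at a vertex

  module Root (c : Fin n) where

    path : ∀ x → ∃ (IsPath T x c)
    path x = conn⇒path (proj₁ tree x c)

    -- The default `c` makes the root its own parent.
    second : List (Fin n) → Fin n
    second (_ ∷ z ∷ _) = z
    second _           = c

    par : Fin n → Fin n
    par x = second (proj₁ (path x))

    dep : Fin n → ℕ
    dep x = length (proj₁ (path x))

    -- By uniqueness, the path from `par x` is the tail of the path from `x`.
    par-spec : ∀ {x} → x ≢ c → Adj T x (par x) × dep x ≡ suc (dep (par x))
    par-spec {x} ne with path x
    ... | _ , here , _ = contradiction refl ne
    ... | _ , step a here , _ ∷ u = a , cong (suc ∘ length) (path-unique (here , u) (proj₂ (path _)))
    ... | _ , step a (step b w) , _ ∷ u = a , cong (suc ∘ length) (path-unique (step b w , u) (proj₂ (path _)))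

    dep-par : ∀ {x} → x ≢ c → dep x ≡ suc (dep (par x))
    dep-par = proj₂ ∘ par-spec

    open Rooted c par dep dep-par public

    toward-root : ∀ {u v} → Adj T u v → Conn (delete T u v) v c → par u ≡ v
    toward-root {u} {v} uv vc with path u
    ... | vs , w , uq with separated⇒consec uv w conn-refl vc
    toward-root uv vc | _ , step _ _ , _ | inj₁ here = refl
    toward-root uv vc | _ , step _ w , u∉ ∷ _ | inj₁ (there k) = contradiction (proj₁ (consec∈ k)) (All¬⇒¬Any u∉)
    toward-root uv vc | _ , step _ w , u∉ ∷ _ | inj₂ here = contradiction uv (loopless T)
    toward-root uv vc | _ , step _ w , u∉ ∷ _ | inj₂ (there k) = contradiction (proj₂ (consec∈ k)) (All¬⇒¬Any u∉)

    -- The root lies on one side of the edge; the end on the other side is the child, as its path to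
    -- the root has to start with this edge.
    orient : ∀ {u v} → Adj T u v → (u ≢ c × par u ≡ v) ⊎ (v ≢ c × par v ≡ u)
    orient {u} {v} uv with sides uv c
    ... | inj₂ cv = inj₁ ((λ { refl → bridge uv cv }) , toward-root uv (conn-sym cv))
    ... | inj₁ cu = inj₂ ((λ { refl → bridge uv (conn-sym cu) }) ,
                          toward-root (symmetric T uv) (delete-comm {G = T} {u} {v} (conn-sym cu)))

    module _ {w : Fin n} (w≢c : w ≢ c) where

      T∖w = delete T w (par w)

      edge : Adj T w (par w)
      edge = proj₁ (par-spec w≢c)

      ⊑⇒conn : ∀ {x} → x ⊑ w → Conn T∖w x w
      ⊑⇒conn done = conn-refl
      ⊑⇒conn {x} (up x≢c p) = conn-step (proj₁ (par-spec x≢c) , distinct) (⊑⇒conn p)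
        where
        distinct : ¬ SameEdge x (par x) w (par w)
        distinct (inj₁ (refl , _)) = ⋢-child x≢c p
        distinct (inj₂ (refl , e)) = <-asym (dep-par< w≢c) (subst (λ t → dep t < dep x) e (dep-par< x≢c))

      conn⇒⊑ : ∀ {x} → Conn T∖w x w → x ⊑ w
      conn⇒⊑ (_ , here) = done
      conn⇒⊑ (_ , step {x} {z} (a , ne) k) with orient a | conn⇒⊑ (_ , k)
      ... | inj₁ (x≢c , refl) | p = up x≢c p
      -- A step from the parent of `w` to `w` would be the deleted edge.
      ... | inj₂ (z≢c , refl) | done = contradiction (inj₂ (refl , refl)) ne
      ... | inj₂ (z≢c , refl) | up _ p = p

      conn⇒⋢ : ∀ {x} → Conn T∖w x (par w) → ¬ x ⊑ w
      conn⇒⋢ k p = bridge edge (conn-trans (conn-sym (⊑⇒conn p)) k)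

      ⋢⇒conn : ∀ {x} → ¬ x ⊑ w → Conn T∖w x (par w)
      ⋢⇒conn {x} ¬p with sides edge x
      ... | inj₁ k = contradiction (conn⇒⊑ k) ¬p
      ... | inj₂ k = k

      onPath⇒sep : ∀ {x y} → OnPath T w (par w) x y → Sep w (x , y)
      onPath⇒sep {x} {y} (_ , p , inj₁ k) with consec⇒sides p k
      ... | l , r = x , y , inj₁ refl , conn⇒⊑ l , conn⇒⋢ (conn-sym r)
      onPath⇒sep {x} {y} (_ , p , inj₂ k) with consec⇒sides p k
      ... | l , r = y , x , inj₂ refl , conn⇒⊑ (conn-sym (delete-comm {G = T} {par w} {w} r)) , conn⇒⋢ (delete-comm {G = T} {par w} {w} l)

      sep⇒onPath : ∀ {x y} → Sep w (x , y) → OnPath T w (par w) x y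
      sep⇒onPath {x} {y} s with conn⇒path (proj₁ tree x y)
      sep⇒onPath (_ , _ , inj₁ refl , p , q) | vs , k , uq = vs , (k , uq) ,
        separated⇒consec edge k (⊑⇒conn p) (conn-sym (⋢⇒conn q))
      sep⇒onPath (_ , _ , inj₂ refl , p , q) | vs , k , uq = vs , (k , uq) ,
        swap (separated⇒consec (symmetric T edge) k (delete-comm {G = T} {w} {par w} (⋢⇒conn q))
          (conn-sym (delete-comm {G = T} {w} {par w} (⊑⇒conn p))))

      ∈crossing⇒ : ∀ {p} → p ∈ crossing w → proj₁ p F.< proj₂ p × Sep w p
      ∈crossing⇒ i with ∈-map⁻ (uncurry sort) i
      ... | (z , z′) , j , refl with ∈-cartesianProduct⁻ (subset (_⊑? w)) _ j
      ... | z∈ , z′∈ with ∈-subset⁻ (_⊑? w) z∈ | ∈-subset⁻ (λ x → ¬? (x ⊑? w)) z′∈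
      ... | z⊑w | z′⋢w with z F.<? z′
      ... | yes h = h , z , z′ , inj₁ refl , z⊑w , z′⋢w
      ... | no h = ≤∧≢⇒< (≮⇒≥ h) (λ e → z′⋢w (subst (_⊑ w) (F.toℕ-injective (sym e)) z⊑w)) , z , z′ , inj₂ refl , z⊑w , z′⋢w

      -- If two pairs became equal only after a swap, one vertex would lie both inside and outside
      -- the subtree at `w`.
      sort-injective : ∀ {p q} → p ∈ _ → q ∈ _ → uncurry sort p ≡ uncurry sort q → p ≡ q
      sort-injective {z , z′} {s , s′} i j e with ∈-cartesianProduct⁻ (subset (_⊑? w)) (subset (λ x → ¬? (x ⊑? w))) i
                                              | ∈-cartesianProduct⁻ (subset (_⊑? w)) (subset (λ x → ¬? (x ⊑? w))) j
      ... | z∈ , z′∈ | s∈ , s′∈ with z F.<? z′ | s F.<? s′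
      ... | yes _ | yes _ = e
      ... | no _  | no _ with refl ← e = refl
      sort-injective i j e | z∈ , z′∈ | s∈ , s′∈ | yes _ | no _ with refl ← e =
        contradiction (∈-subset⁻ (_⊑? w) z∈) (∈-subset⁻ (λ x → ¬? (x ⊑? w)) s′∈)
      sort-injective i j e | z∈ , z′∈ | s∈ , s′∈ | no _ | yes _ with refl ← e =
        contradiction (∈-subset⁻ (_⊑? w) s∈) (∈-subset⁻ (λ x → ¬? (x ⊑? w)) z′∈)

      load : Load T w (par w) (size w * cosize w)
      load = crossing w ,
        unique-map (uncurry sort) (cartesianProduct⁺ (filter⁺ (_⊑? w) (allFin⁺ n)) (filter⁺ (λ x → ¬? (x ⊑? w)) (allFin⁺ n))) sort-injective ,
        (λ p → mk⇔ (λ i → let h , s = ∈crossing⇒ i in h , sep⇒onPath s)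
                   (λ { (h , o) → sep⇒∈crossing h (onPath⇒sep o) })) ,
        length-crossing w

    shareEdge⇒conflict : ∀ {x y x′ y′} → x F.< y → x′ F.< y′ → ShareEdge T x y x′ y′ → Conflict (x , y) (x′ , y′)
    shareEdge⇒conflict h h′ (u , v , uv , o , o′) with orient uv
    ... | inj₁ (ne , refl) = h , h′ , u , ne , onPath⇒sep ne o , onPath⇒sep ne o′
    ... | inj₂ (ne , refl) = h , h′ , v , ne , onPath⇒sep ne (onPath-sym {G = T} {u} {v} o) , onPath⇒sep ne (onPath-sym {G = T} {u} {v} o′)

    -- The root is the endpoint of a maximum-load edge on its larger side.
    bound : ∀ {w k π} → k ≢ c → par k ≡ c → size k ≤ cosize k →
      IsOpticalIndex T w → IsForwardingIndex T π → π ≡ size k * cosize k → 2 * w < 3 * π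
    bound {w} {k} k≢c pk a≤b optical forwarding refl with half (3 * (size k * cosize k)) 1≤3ab
      where
      1≤a : 1 ≤ size k
      1≤a = count-pos (_⊑? k) done
      1≤3ab : 1 ≤ 3 * (size k * cosize k)
      1≤3ab = *-mono-≤ {1} {3} (s≤s z≤n) (*-mono-≤ 1≤a (≤-trans 1≤a a≤b))
    ... | K , 2K< , fits = ≤-<-trans (*-monoʳ-≤ 2 (proj₂ optical K colourable)) 2K<
      where
      -- The edge at `v` has no larger load than the one at `k`. The root lies outside both
      -- branches, so the remainder `r` is positive and can be cancelled.
      branch-size : ∀ {v} → v ≢ c → par v ≡ c → size v ≤ size k
      branch-size {v} v≢c pv with v F.≟ k
      ... | yes refl = ≤-refl
      ... | no v≢k = cross-cancel (size k) (size v) r 1≤r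
              (subst₂ _≤_ (cong (size v *_) cov) (cong (size k *_) cok) (proj₂ forwarding v (par v) _ (edge v≢c) (load v≢c)))
        where
        disjoint : ∀ {z} → z ⊑ k → z ⊑ v → ⊥
        disjoint p q = v≢k (sym (siblings-unique k≢c v≢c (trans pk (sym pv)) p q))
        r = count (outside? disjoint)
        1≤r : 1 ≤ r
        1≤r = count-pos (outside? disjoint) ((λ h → k≢c (root-⊑ h)) , (λ h → v≢c (root-⊑ h)))
        cok : cosize k ≡ size v + r
        cok = +-cancelˡ-≡ (size k) _ _ (trans (size+cosize k) (trans (sym (count-partition disjoint)) (+-assoc (size k) (size v) r)))
        cov : cosize v ≡ size k + r
        cov = +-cancelˡ-≡ (size v) _ _ (trans (size+cosize v) (trans (sym (count-partition disjoint))
          (trans (cong (_+ r) (+-comm (size k) (size v))) (+-assoc (size v) (size k) r))))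
      open Colouring (size k) (cosize k) K (size+cosize k) a≤b (count-pos (_⊑? k) done) branch-size fits using (colouring)
      colourable : HasProperColoring T K
      colourable with colouring
      ... | φ , φ<K , proper = (λ x y → fromℕ< (φ<K (x , y))) , λ x y x′ y′ h h′ ne share e →
        proper (shareEdge⇒conflict h h′ share) (λ { refl → ne (refl , refl) }) (F.fromℕ<-injective _ _ (φ<K (x , y)) (φ<K (x′ , y′)) e)

theorem2p2 : (n : ℕ) → 2 ≤ n → (T : SimpleGraph n) → IsTree T →
    (w π : ℕ) → IsOpticalIndex T w → IsForwardingIndex T π →
    2 * w < 3 * π
theorem2p2 n _ T tree w π optical forwarding@((u , v , uv , uvload) , _) = main
  where
  open Tree T tree
  -- Both ends of the maximum-load edge are prepared as roots; the two rootings see the same sides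
  -- of the edge with their roles exchanged.
  module U = Root u
  module V = Root v
  v≢u : v ≢ u
  v≢u refl = loopless T uv
  pv : U.par v ≡ u
  pv with U.orient uv
  ... | inj₁ (ne , _) = contradiction refl ne
  ... | inj₂ (_ , e) = e
  pu : V.par u ≡ v
  pu with V.orient uv
  ... | inj₁ (_ , e) = e
  ... | inj₂ (ne , _) = contradiction refl ne
  π≡u : π ≡ U.size v * U.cosize v
  π≡u = load-unique uvload (load-sym {v} {u} (subst (λ t → Load T v t (U.size v * U.cosize v)) pv (U.load v≢u)))
  π≡v : π ≡ V.size u * V.cosize u
  π≡v = load-unique uvload (subst (λ t → Load T u t (V.size u * V.cosize u)) pu (V.load (v≢u ∘ sym)))
  -- Both conditions mean being connected to `u` after deletion of the edge.
  complementary : ∀ {x} → ¬ x U.⊑ v → x V.⊑ u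
  complementary h = V.conn⇒⊑ (v≢u ∘ sym) (subst (λ t → Conn (delete T u t) _ u) (sym pu)
    (delete-comm {G = T} {v} {u} (subst (λ t → Conn (delete T v t) _ t) pv (U.⋢⇒conn v≢u h))))
  complementary′ : ∀ {x} → x V.⊑ u → ¬ x U.⊑ v
  complementary′ h = U.conn⇒⋢ v≢u (subst (λ t → Conn (delete T v t) _ t) (sym pv)
    (delete-comm {G = T} {u} {v} (subst (λ t → Conn (delete T u t) _ u) pu (V.⊑⇒conn (v≢u ∘ sym) h))))
  size-u : V.size u ≡ U.cosize v
  size-u = ≤-antisym (count-mono (V._⊑? u) (λ x → ¬? (x U.⊑? v)) complementary′)
                     (count-mono (λ x → ¬? (x U.⊑? v)) (V._⊑? u) complementary)
  cosize-u : V.cosize u ≡ U.size v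
  cosize-u = +-cancelˡ-≡ (V.size u) _ _ (trans (V.size+cosize u) (trans (sym (U.size+cosize v))
    (trans (+-comm (U.size v) _) (cong (_+ U.size v) (sym size-u)))))
  main : 2 * w < 3 * π
  main with ≤-total (U.size v) (U.cosize v)
  ... | inj₁ h = U.bound v≢u pv h optical forwarding π≡u
  ... | inj₂ h = V.bound (v≢u ∘ sym) pu (subst₂ _≤_ (sym size-u) (sym cosize-u) h) optical forwarding π≡v
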